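{- Every minimally $\frac{3}{2}$-tough claw-free graph has a vertex of degree $3$.
   Context: All graphs are finite, simple and undirected. For a graph $G$ and $S\subseteq V(G)$, $w(G-S)$ denotes the number of connected components of $G-S$. The toughness of a noncomplete graph $G$ is $\tau(G)=\min\left\{\frac{|S|}{w(G-S)} : S\subseteq V(G),\ w(G-S)\ge 2\right\}$, and $\tau(G)=+\infty$ if $G$ is complete. A graph $G$ is minimally $t$-tough if $\tau(G)=t$ and $\tau(G-e)<t$ for every edge $e\in E(G)$, where $G-e$ is $G$ with the edge $e$ deleted. A graph is claw-free if it has no induced subgraph isomorphic to $K_{1,3}$. -}

module Defs where

open import Data.Fin using (Fin; zero; suc; toℕ; fromℕ<)
open import Data.Fin.Properties using (_≟_; toℕ<n; fromℕ<-toℕ)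
open import Data.Fin.Subset using (Subset; inside; outside; _∉_; ∣_∣)
open import Data.Fin.Subset.Properties using (_∈?_)
open import Data.Integer using (+_)
open import Data.List using (List; []; _∷_; _++_; map; mapMaybe; filter; length; allFin; deduplicate)
import Data.List.Extrema as Extrema
open import Data.Maybe using (Maybe; just; nothing)
open import Data.Nat using (ℕ; zero; suc; _<_; _<?_)
open import Data.Nat.Properties using (m<1+n⇒m<n∨m≡n)
open import Data.Product using (Σ; _×_; _,_; proj₁; proj₂)
open import Data.Rational as ℚ using (ℚ; _/_)
import Data.Rational.Properties as ℚ
open import Data.Sum using (_⊎_; inj₁; inj₂)
open import Data.Vec using ([]; _∷_)
open import Function using (_⇔_)
open import Function.Definitions using (Injective)
open import Level using (0ℓ)
open import Relation.Binary.Bundles using (TotalOrder)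
open import Relation.Binary.Construct.Add.Supremum.NonStrict ℚ._≤_ using (≤⁺-isTotalOrder-≡)
open import Relation.Binary.Construct.Add.Supremum.Strict ℚ._<_ using (_<⁺_)
open import Relation.Binary.Construct.Closure.ReflexiveTransitive using (Star; ε; _◅_; _◅◅_)
open import Relation.Binary.Core using (Rel)
open import Relation.Binary.Definitions using (Decidable; Symmetric; Irreflexive)
open import Relation.Binary.PropositionalEquality using (_≡_; refl; sym; subst)
open import Relation.Nullary using (¬_)
open import Relation.Nullary.Construct.Add.Supremum using (_⁺; ⊤⁺; [_])
open import Relation.Nullary.Decidable using (Dec; map′; ¬?; _×-dec_; _⊎-dec_; yes; no)

record Graph (n : ℕ) : Set₁ where
  field
    Adj    : Rel (Fin n) 0ℓ
    adj?   : Decidable Adj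
    symm   : Symmetric Adj
    irrefl : Irreflexive _≡_ Adj

open Graph public

degree : ∀ {n} → Graph n → Fin n → ℕ
degree {n} G v = length (filter (adj? G v) (allFin n))

SameEdge : ∀ {n} (u v x y : Fin n) → Set
SameEdge u v x y = (x ≡ u × y ≡ v) ⊎ (x ≡ v × y ≡ u)

deleteEdge : ∀ {n} → Graph n → Fin n → Fin n → Graph n
deleteEdge G u v = record
  { Adj    = λ x y → Adj G x y × ¬ SameEdge u v x y
  ; adj?   = λ x y → adj? G x y ×-dec
               ¬? (((x ≟ u) ×-dec (y ≟ v)) ⊎-dec ((x ≟ v) ×-dec (y ≟ u)))
  ; symm   = λ { (xy , ≢e) → symm G xy , λ
               { (inj₁ (p , q)) → ≢e (inj₂ (q , p))
               ; (inj₂ (p , q)) → ≢e (inj₁ (q , p)) } }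
  ; irrefl = λ p xy → irrefl G p (proj₁ xy)
  }

-- Isomorphisms from H onto an induced subgraph of G.
InducedCopy : ∀ {m n} → Graph m → Graph n → Set
InducedCopy {m} {n} H G = Σ (Fin m → Fin n) λ f →
  Injective _≡_ _≡_ f × (∀ i j → Adj H i j ⇔ Adj G (f i) (f j))

data ClawAdj : Rel (Fin 4) 0ℓ where
  centre-leaf : ∀ i → ClawAdj zero (suc i)
  leaf-centre : ∀ i → ClawAdj (suc i) zero

K₁,₃ : Graph 4
K₁,₃ = record
  { Adj    = ClawAdj
  ; adj?   = λ { zero    zero    → no λ ()
               ; zero    (suc j) → yes (centre-leaf j)
               ; (suc i) zero    → yes (leaf-centre i)
               ; (suc i) (suc j) → no λ () }
  ; symm   = λ { (centre-leaf i) → leaf-centre i ; (leaf-centre i) → centre-leaf i }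
  ; irrefl = λ { refl () }
  }

ClawFree : ∀ {n} → Graph n → Set
ClawFree G = ¬ InducedCopy K₁,₃ G

-- Decidability of reachability in a finite decidable relation, by Warshall's
-- algorithm: Via k x y only allows intermediate vertices below k.
module _ {n} {R : Rel (Fin n) 0ℓ} (R? : Decidable R) where

  private
    Via : ℕ → Rel (Fin n) 0ℓ
    Via zero    x y = x ≡ y ⊎ R x y
    Via (suc k) x y = Via k x y ⊎ Σ (k < n) λ k<n → Via k x (fromℕ< k<n) × Via k (fromℕ< k<n) y

    via? : ∀ k → Decidable (Via k)
    via? zero    x y = (x ≟ y) ⊎-dec R? x y
    via? (suc k) x y = via? k x y ⊎-dec step (k <? n)
      where
      step : Dec (k < n) → Dec (Σ (k < n) λ k<n → Via k x (fromℕ< k<n) × Via k (fromℕ< k<n) y)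
      step (no k≮n)  = no λ p → k≮n (proj₁ p)
      step (yes k<n) = map′ (k<n ,_) proj₂
        (via? k x (fromℕ< k<n) ×-dec via? k (fromℕ< k<n) y)

    sound : ∀ k {x y} → Via k x y → Star R x y
    sound zero    (inj₁ refl)        = ε
    sound zero    (inj₂ xy)          = xy ◅ ε
    sound (suc k) (inj₁ p)           = sound k p
    sound (suc k) (inj₂ (_ , p , q)) = sound k p ◅◅ sound k q

    join : ∀ k {x y z} → toℕ z < k → Via k x z → Via k z y → Via k x y
    join (suc k) {x} {y} {z} z<1+k p q with m<1+n⇒m<n∨m≡n z<1+k
    join (suc k) z< (inj₁ p) (inj₁ q) | inj₁ z<k = inj₁ (join k z<k p q)
    join (suc k) z< (inj₁ p) (inj₂ (k<n , q , r)) | inj₁ z<k = inj₂ (k<n , join k z<k p q , r)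
    join (suc k) z< (inj₂ (k<n , p , q)) (inj₁ r) | inj₁ z<k = inj₂ (k<n , p , join k z<k q r)
    join (suc k) z< (inj₂ (k<n , p , _)) (inj₂ (_ , _ , r)) | inj₁ z<k = inj₂ (k<n , p , r)
    join (suc .(toℕ z)) {x} {y} {z} z< p q | inj₂ refl =
      inj₂ (toℕ<n z , subst (Via (toℕ z) x) z≡ (into p) , subst (λ v → Via (toℕ z) v y) z≡ (out q))
      where
      z≡ : z ≡ fromℕ< (toℕ<n z)
      z≡ = sym (fromℕ<-toℕ z (toℕ<n z))
      into : Via (suc (toℕ z)) x z → Via (toℕ z) x z
      into (inj₁ p)           = p
      into (inj₂ (_ , p , _)) = subst (Via (toℕ z) x) (fromℕ<-toℕ z _) p
      out : Via (suc (toℕ z)) z y → Via (toℕ z) z y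
      out (inj₁ q)           = q
      out (inj₂ (_ , _ , q)) = subst (λ v → Via (toℕ z) v y) (fromℕ<-toℕ z _) q

    lift : ∀ k {x y} → Via zero x y → Via k x y
    lift zero    p = p
    lift (suc k) p = inj₁ (lift k p)

    complete : ∀ {x y} → Star R x y → Via n x y
    complete ε                  = lift n (inj₁ refl)
    complete (_◅_ {j = z} xz p) = join n (toℕ<n z) (lift n (inj₂ xz)) (complete p)

  star? : Decidable (Star R)
  star? x y = map′ (sound n) complete (via? n x y)

module _ {n} (G : Graph n) (S : Subset n) where

  Adj∖ : Rel (Fin n) 0ℓ
  Adj∖ u v = u ∉ S × v ∉ S × Adj G u v

  adj∖? : Decidable Adj∖
  adj∖? u v = ¬? (u ∈? S) ×-dec ¬? (v ∈? S) ×-dec adj? G u v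

  Connected∖ : Rel (Fin n) 0ℓ
  Connected∖ = Star Adj∖

  connected∖? : Decidable Connected∖
  connected∖? = star? adj∖?

  -- The number of components of G - S: one representative is kept from each
  -- connectedness class of the vertices outside S.
  w : ℕ
  w = length (deduplicate connected∖? (filter (λ v → ¬? (v ∈? S)) (allFin n)))

subsets : ∀ n → List (Subset n)
subsets zero    = [] ∷ []
subsets (suc n) = map (inside ∷_) (subsets n) ++ map (outside ∷_) (subsets n)

ratio : (s c : ℕ) → Maybe ℚ
ratio s (suc (suc c)) = just (+ s / suc (suc c))
ratio s _             = nothing

ℚ⁺-totalOrder : TotalOrder 0ℓ 0ℓ 0ℓ
ℚ⁺-totalOrder = record { isTotalOrder = ≤⁺-isTotalOrder-≡ ℚ.≤-isTotalOrder }

-- ⊤⁺ plays the role of +∞.  The list of ratios is empty exactly when G is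
-- complete, so the default value of the minimum covers that case.
toughness : ∀ {n} → Graph n → ℚ ⁺
toughness {n} G =
  Extrema.min ℚ⁺-totalOrder ⊤⁺ (map [_] (mapMaybe (λ S → ratio ∣ S ∣ (w G S)) (subsets n)))

MinimallyTough : ∀ {n} → ℚ → Graph n → Set
MinimallyTough t G =
  toughness G ≡ [ t ] × (∀ u v → Adj G u v → toughness (deleteEdge G u v) <⁺ [ t ])

{-# OPTIONS --safe #-}

-- A toughness bound only sees labellings of the vertices off a cut that are constant along
-- edges, so connectedness of components is never needed.  For a claw-free graph a cut vertex
-- meets at most two labels, and toughness 3/2 amounts to 3-connectedness with some 3-vertex cut.
-- Suppose all degrees are at least 4 and let F be a smallest fragment, i.e. a set with a
-- 3-vertex boundary X and a nonempty exterior.  Every edge uv is critical.  Either two vertices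
-- separate u from v in G - uv, which uncrossing with F rules out for edges between X and F or
-- inside F; or counting incidences between a deficient cut of G - uv and its classes forces
-- common neighbours of u and v that also meet a third class.  Applied to the edges between X and
-- F this makes every x in X have degree 4, with three neighbours off the exterior forming a
-- clique with it, and then the edge leaving that clique from a neighbour of x in F cannot be
-- critical.

module Submission where

open import Defs
open import Data.Nat using (ℕ)
open import Data.Integer using (+_)
open import Data.Rational using (_/_)
open import Data.Product using (∃-syntax)
open import Relation.Binary.PropositionalEquality using (_≡_)

open import Data.Bool using (true; false; if_then_else_)
open import Data.Empty using (⊥; ⊥-elim)
open import Data.Fin using (Fin; zero; suc)
open import Data.Fin.Properties using (_≟_; any?)
open import Data.Fin.Subset using (Subset; inside; outside; ∣_∣)
import Data.Fin.Subset as Subset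
open import Data.Fin.Subset.Properties using () renaming (_∈?_ to _∈ˢ?_)
import Data.Integer as ℤ
import Data.Integer.Properties as ℤ
open import Data.List using (List; []; _∷_; length; filter; map; allFin; lookup; deduplicate; tabulate; mapMaybe)
import Data.List.Extrema as Extrema
import Data.List.Membership.DecPropositional as DecMembership
open import Data.List.Membership.Propositional using (find) renaming (_∈_ to _∈ˡ_; _∉_ to _∉ˡ_)
open import Data.List.Membership.Propositional.Properties
  using (∈-filter⁺; ∈-filter⁻; ∈-allFin; ∈-lookup; ∈-map⁺; ∈-map⁻; ∈-++⁺ˡ; ∈-++⁺ʳ; ∈-deduplicate⁻)
open import Data.List.Properties using (length-filter; length-map; length-tabulate)
open import Data.List.Relation.Unary.All as All using (All; []; _∷_)
import Data.List.Relation.Unary.All.Properties as All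
open import Data.List.Relation.Unary.AllPairs using (AllPairs; []; _∷_)
import Data.List.Relation.Unary.AllPairs.Properties as AllPairs
open import Data.List.Relation.Unary.Any as Any using (Any; here; there)
import Data.List.Relation.Unary.Any.Properties as Any
open import Data.List.Relation.Unary.Unique.Propositional using (Unique)
import Data.List.Relation.Unary.Unique.Propositional.Properties as Unique
open import Data.Maybe using (Maybe; just; nothing)
import Data.Maybe.Properties as Maybe
open import Data.Nat using (zero; suc; _+_; _*_; _≤_; _<_; z≤n; s≤s; s≤s⁻¹; _≤?_)
open import Data.Nat.Induction using (<-wellFounded)
open import Data.Nat.ListAction using (sum)
import Data.Nat.Properties as ℕ
open import Data.Nat.Properties hiding (_≟_)
open import Data.Nat.Tactic.RingSolver using (solve-∀)
open import Data.Product using (Σ; ∃; ∃₂; _×_; _,_; proj₁; proj₂)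
open import Data.Rational as ℚ using (ℚ)
import Data.Rational.Properties as ℚ
import Data.Rational.Unnormalised as ℚᵘ
import Data.Rational.Unnormalised.Properties as ℚᵘ
open import Data.Sum using (_⊎_; inj₁; inj₂; [_,_]′)
open import Data.Vec using ([]; _∷_; here; there)
import Data.Vec as Vec
import Data.Vec.Properties as Vec
open import Function using (_∘_; id; mk⇔)
open import Induction.WellFounded using (Acc; acc)
open import Level using (0ℓ)
import Relation.Binary.Construct.Add.Supremum.NonStrict ℚ._≤_ as ≤⁺
import Relation.Binary.Construct.Add.Supremum.Strict ℚ._<_ as <⁺
open import Relation.Binary.Construct.Closure.ReflexiveTransitive using (ε; _◅_; _◅◅_; reverse)
open import Relation.Binary.Definitions using (Symmetric; DecidableEquality)
open import Relation.Binary.PropositionalEquality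
  using (_≢_; refl; sym; trans; cong; cong₂; subst; subst₂)
open import Relation.Nullary using (¬_; Dec; yes; no; does; contradiction)
open import Relation.Nullary.Construct.Add.Supremum using (⊤⁺; [_])
open import Relation.Nullary.Decidable using (¬?; _×-dec_; _⊎-dec_)
open import Relation.Unary using (Pred; Decidable)

-- Counting in finite sets

-- The count behind a strong split has a slack of one. With `r` further classes a deficient cut
-- satisfies 2|off| ≤ 5 + 3r, whereas r + 2 classes with at least three neighbours each need 6 + 3r
-- incidences with the cut. So some cut vertex meets three classes; claw-freeness then makes two of
-- its three neighbours adjacent, and the only edge between different classes is uv. Hence the
-- common neighbours of u and v. A common neighbour of u and v that meets no third class can instead
-- be absorbed when the classes of u and v are merged. Toughness tolerates at most one of these, and
-- one makes the merged cut tight: its classes then have three-vertex boundaries and can be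
-- uncrossed with F. The obstacle is a small F. Uncrossing needs an exterior vertex that avoids the
-- second set and its boundary; without one the exterior is squeezed into few separating vertices,
-- and only |exterior| ≥ |F| ≥ 3 contradicts this. A two-vertex F is therefore excluded beforehand:
-- there degree four makes both vertices adjacent to each other and to all of X, and edges inside X
-- give the contradiction.

private variable
  𝔸 𝔹 : Set

private
  interchange : ∀ a b c d → (a + b) + (c + d) ≡ (a + c) + (b + d)
  interchange = solve-∀

𝟙 : ∀ {P : Set} → Dec P → ℕ
𝟙 d = if does d then 1 else 0

𝟙-yes : ∀ {P : Set} (d : Dec P) → P → 𝟙 d ≡ 1
𝟙-yes (yes _) _ = refl
𝟙-yes (no ¬p) p = contradiction p ¬p

𝟙-modular : ∀ {P Q R S : Set} (p : Dec P) (q : Dec Q) (r : Dec R) (s : Dec S) →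
  (P → Q → R × S) → (P ⊎ Q → R ⊎ S) → 𝟙 p + 𝟙 q ≤ 𝟙 r + 𝟙 s
𝟙-modular (yes p) (yes q) r s and or
  rewrite 𝟙-yes r (proj₁ (and p q)) | 𝟙-yes s (proj₂ (and p q)) = ≤-refl
𝟙-modular (yes p) (no ¬q) r s and or with or (inj₁ p)
... | inj₁ x rewrite 𝟙-yes r x = s≤s z≤n
... | inj₂ y rewrite 𝟙-yes s y = m≤n+m 1 (𝟙 r)
𝟙-modular (no ¬p) (yes q) r s and or with or (inj₂ q)
... | inj₁ x rewrite 𝟙-yes r x = s≤s z≤n
... | inj₂ y rewrite 𝟙-yes s y = m≤n+m 1 (𝟙 r)
𝟙-modular (no ¬p) (no ¬q) r s and or = z≤n

count : {P : Pred 𝔸 0ℓ} → Decidable P → List 𝔸 → ℕ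
count P? xs = length (filter P? xs)

count-∷ : {P : Pred 𝔸 0ℓ} (P? : Decidable P) (x : 𝔸) (xs : List 𝔸) → count P? (x ∷ xs) ≡ 𝟙 (P? x) + count P? xs
count-∷ P? x xs with does (P? x)
... | true  = refl
... | false = refl

count-modular : {P Q R S : Pred 𝔸 0ℓ} (P? : Decidable P) (Q? : Decidable Q) (R? : Decidable R) (S? : Decidable S) →
  (∀ x → P x → Q x → R x × S x) → (∀ x → P x ⊎ Q x → R x ⊎ S x) →
  (xs : List 𝔸) → count P? xs + count Q? xs ≤ count R? xs + count S? xs
count-modular P? Q? R? S? and or []       = z≤n
count-modular P? Q? R? S? and or (x ∷ xs)
  rewrite count-∷ P? x xs | count-∷ Q? x xs | count-∷ R? x xs | count-∷ S? x xs =
  subst₂ _≤_ (interchange (𝟙 (P? x)) (𝟙 (Q? x)) (count P? xs) (count Q? xs))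
             (interchange (𝟙 (R? x)) (𝟙 (S? x)) (count R? xs) (count S? xs))
    (+-mono-≤ (𝟙-modular (P? x) (Q? x) (R? x) (S? x) (and x) (or x))
              (count-modular P? Q? R? S? and or xs))

module _ (_≟ᴬ_ : DecidableEquality 𝔸) where
  open DecMembership _≟ᴬ_ using (_∈?_)

  remove : 𝔸 → List 𝔸 → List 𝔸
  remove y = filter (λ x → ¬? (x ≟ᴬ y))

  length-remove : ∀ {y xs} → y ∈ˡ xs → suc (length (remove y xs)) ≤ length xs
  length-remove {y} {x ∷ xs} y∈ with x ≟ᴬ y
  length-remove {y} {x ∷ xs} y∈ | yes refl = s≤s (length-filter (λ x → ¬? (x ≟ᴬ y)) xs)
  length-remove {y} {x ∷ xs} (here refl) | no x≢y = contradiction refl x≢y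
  length-remove {y} {x ∷ xs} (there y∈)  | no x≢y = s≤s (length-remove y∈)

  length-⊆ : ∀ {xs ys} → Unique xs → (∀ {x} → x ∈ˡ xs → x ∈ˡ ys) → length xs ≤ length ys
  length-⊆ {[]}     []         sub = z≤n
  length-⊆ {x ∷ xs} (x∉ ∷ xs!) sub = ≤-trans
    (s≤s (length-⊆ xs! λ y∈ → ∈-filter⁺ (λ y → ¬? (y ≟ᴬ x)) (sub (there y∈))
      λ { refl → All.lookup x∉ y∈ refl }))
    (length-remove (sub (here refl)))

  abstract

    pigeonhole : ∀ {xs ys : List 𝔸} → Unique xs → length ys < length xs → ∃ λ x → x ∈ˡ xs × x ∉ˡ ys
    pigeonhole {xs} {ys} xs! ys<xs with Any.any? (λ x → ¬? (x ∈? ys)) xs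
    ... | yes some = find some
    ... | no none = contradiction (length-⊆ xs! sub) (<⇒≱ ys<xs)
      where
      sub : ∀ {x} → x ∈ˡ xs → x ∈ˡ ys
      sub {x} x∈ with x ∈? ys
      ... | yes x∈ys = x∈ys
      ... | no  x∉ys = contradiction (Any.map (λ { refl → x∉ys }) x∈) none

    -- 𝔸 predicate holding at more than length ys elements of xs holds at one outside ys.
    count-pigeonhole : {P : Pred 𝔸 0ℓ} (P? : Decidable P) {xs ys : List 𝔸} → Unique xs →
      length ys < count P? xs → ∃ λ x → x ∈ˡ xs × P x × x ∉ˡ ys
    count-pigeonhole P? xs! lt with pigeonhole (Unique.filter⁺ P? xs!) lt
    ... | x , x∈ , x∉ys with ∈-filter⁻ P? x∈
    ... | x∈xs , px = x , x∈xs , px , x∉ys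

weigh : (𝔸 → ℕ) → List 𝔸 → ℕ
weigh f xs = sum (map f xs)

weigh-+ : (f g : 𝔸 → ℕ) (xs : List 𝔸) → weigh (λ x → f x + g x) xs ≡ weigh f xs + weigh g xs
weigh-+ f g []       = refl
weigh-+ f g (x ∷ xs) rewrite weigh-+ f g xs = interchange (f x) (g x) (weigh f xs) (weigh g xs)

weigh-cong : {f g : 𝔸 → ℕ} (xs : List 𝔸) → (∀ x → f x ≡ g x) → weigh f xs ≡ weigh g xs
weigh-cong []       eq = refl
weigh-cong (x ∷ xs) eq = cong₂ _+_ (eq x) (weigh-cong xs eq)

weigh-0 : (xs : List 𝔸) → weigh (λ _ → 0) xs ≡ 0
weigh-0 []       = refl
weigh-0 (_ ∷ xs) = weigh-0 xs

weigh-𝟙 : {P : Pred 𝔸 0ℓ} (P? : Decidable P) (xs : List 𝔸) → weigh (𝟙 ∘ P?) xs ≡ count P? xs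
weigh-𝟙 P? []       = refl
weigh-𝟙 P? (x ∷ xs) rewrite count-∷ P? x xs = cong (_+_ (𝟙 (P? x))) (weigh-𝟙 P? xs)

weigh-≥ : {f : 𝔸 → ℕ} {k : ℕ} (xs : List 𝔸) → All (λ x → k ≤ f x) xs → k * length xs ≤ weigh f xs
weigh-≥ {k = k} []       []       rewrite *-zeroʳ k = z≤n
weigh-≥ {k = k} (x ∷ xs) (p ∷ ps) rewrite *-suc k (length xs) = +-mono-≤ p (weigh-≥ xs ps)

weigh-> : {f : 𝔸 → ℕ} {k : ℕ} {y : 𝔸} (xs : List 𝔸) → All (λ x → k ≤ f x) xs →
  y ∈ˡ xs → k < f y → k * length xs < weigh f xs
weigh-> {k = k} (x ∷ xs) (p ∷ ps) (here refl) q rewrite *-suc k (length xs) = +-mono-≤ q (weigh-≥ xs ps)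
weigh-> {f = f} {k = k} (x ∷ xs) (p ∷ ps) (there y∈) q rewrite *-suc k (length xs) =
  subst (_≤ f x + weigh f xs) (+-suc k (k * length xs)) (+-mono-≤ p (weigh-> xs ps y∈ q))

-- Exchanges the order of summation. `T` holds the elements that are allowed one incidence beyond
-- two; with `T` empty this is the count for an ordinary cut.
double-counting : {R : 𝔸 → 𝔹 → Set} {S T : Pred 𝔹 0ℓ}
  (R? : ∀ a → Decidable (R a)) (S? : Decidable S) (T? : Decidable T) (as : List 𝔸) →
  (∀ b → count (λ a → R? a b) as ≤ 2 * 𝟙 (S? b) + 𝟙 (T? b)) →
  (bs : List 𝔹) → weigh (λ a → count (R? a) bs) as ≤ 2 * count S? bs + count T? bs
double-counting R? S? T? as bound []       rewrite weigh-0 as = z≤n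
double-counting R? S? T? as bound (b ∷ bs)
  rewrite weigh-cong as (λ a → count-∷ (R? a) b bs)
        | weigh-+ (λ a → 𝟙 (R? a b)) (λ a → count (R? a) bs) as
        | weigh-𝟙 (λ a → R? a b) as | count-∷ S? b bs | count-∷ T? b bs =
  ≤-trans (+-mono-≤ (bound b) (double-counting R? S? T? as bound bs))
    (≤-reflexive (arrange (𝟙 (S? b)) (𝟙 (T? b)) (count S? bs) (count T? bs)))
  where
  arrange : ∀ s t s′ t′ → (2 * s + t) + (2 * s′ + t′) ≡ 2 * (s + s′) + (t + t′)
  arrange = solve-∀

-- Decidable vertex sets and their sizes

record DSet (n : ℕ) : Set₁ where
  constructor ⟪_⟫
  field
    {Member} : Pred (Fin n) 0ℓ
    member?  : Decidable Member

open DSet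

infix 4 _∈_ _∉_

_∈_ _∉_ : ∀ {n} → Fin n → DSet n → Set
v ∈ A = Member A v
v ∉ A = ¬ (v ∈ A)

card : ∀ {n} → DSet n → ℕ
card {n} A = count (member? A) (allFin n)

elements : ∀ {n} → DSet n → List (Fin n)
elements {n} A = filter (member? A) (allFin n)

∈-elements⁺ : ∀ {n} (A : DSet n) {v} → v ∈ A → v ∈ˡ elements A
∈-elements⁺ A {v} v∈A = ∈-filter⁺ (member? A) (∈-allFin v) v∈A

∈-elements⁻ : ∀ {n} (A : DSet n) {v} → v ∈ˡ elements A → v ∈ A
∈-elements⁻ {n} A v∈ = proj₂ (∈-filter⁻ (member? A) {xs = allFin n} v∈)

elements! : ∀ {n} (A : DSet n) → Unique (elements A)
elements! {n} A = Unique.filter⁺ (member? A) (Unique.allFin⁺ n)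

module _ {n : ℕ} where
  open DecMembership (_≟_ {n}) using (_∈?_)

  _∩_ _∪_ _∖_ : DSet n → DSet n → DSet n
  A ∩ B = ⟪ (λ v → member? A v ×-dec member? B v) ⟫
  A ∪ B = ⟪ (λ v → member? A v ⊎-dec member? B v) ⟫
  A ∖ B = ⟪ (λ v → member? A v ×-dec ¬? (member? B v)) ⟫

  ∅ : DSet n
  ∅ = ⟪ (λ _ → no (λ (b : ⊥) → b)) ⟫

  fromList : List (Fin n) → DSet n
  fromList xs = ⟪ (_∈? xs) ⟫

  abstract

    -- Also serves disjoint `A` and `B`, where the first hypothesis is vacuous and only the union
    -- has to be covered.
    card-modular : ∀ (A B C D : DSet n) → (∀ v → v ∈ A → v ∈ B → v ∈ C × v ∈ D) →
      (∀ v → v ∈ A ⊎ v ∈ B → v ∈ C ⊎ v ∈ D) → card A + card B ≤ card C + card D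
    card-modular A B C D and or =
      count-modular (member? A) (member? B) (member? C) (member? D) and or (allFin n)

    card-mono : ∀ (A B : DSet n) → (∀ v → v ∈ A → v ∈ B) → card A ≤ card B
    card-mono A B A⊆B = length-⊆ (_≟_ {n}) (elements! A) λ {v} v∈ → ∈-elements⁺ B (A⊆B v (∈-elements⁻ A v∈))

    card-≤ : ∀ (A : DSet n) xs → (∀ v → v ∈ A → v ∈ˡ xs) → card A ≤ length xs
    card-≤ A xs sub = length-⊆ (_≟_ {n}) (elements! A) λ {v} v∈ → sub v (∈-elements⁻ A v∈)

    card-≥ : ∀ (A : DSet n) {xs} → Unique xs → All (_∈ A) xs → length xs ≤ card A
    card-≥ A xs! all = length-⊆ (_≟_ {n}) xs! λ v∈ → ∈-elements⁺ A (All.lookup all v∈)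

    avoid : ∀ (A : DSet n) xs → length xs < card A → ∃ λ v → v ∈ A × v ∉ˡ xs
    avoid A xs lt with count-pigeonhole (_≟_ {n}) (member? A) {ys = xs} (Unique.allFin⁺ n) lt
    ... | v , _ , v∈A , v∉xs = v , v∈A , v∉xs

    -- Turns an upper bound on a degree into an explicit list of all neighbours.
    full : ∀ (A : DSet n) {xs} → Unique xs → All (_∈ A) xs → card A ≤ length xs → ∀ {v} → v ∈ A → v ∈ˡ xs
    full A {xs} xs! all le {v} v∈A with v ∈? xs
    ... | yes v∈xs = v∈xs
    ... | no  v∉xs = contradiction
      (card-≥ A (All.tabulate (λ { w∈ refl → v∉xs w∈ }) ∷ xs!) (v∈A ∷ all)) (<⇒≱ (s≤s le))

    -- Counterpart of `full` for a lower bound on a degree: a covering list without slack has no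
    -- member outside `A`.
    saturate : ∀ (A : DSet n) xs → (∀ v → v ∈ A → v ∈ˡ xs) → length xs ≤ card A → ∀ {v} → v ∈ˡ xs → v ∈ A
    saturate A xs sub le {v} v∈xs with member? A v
    ... | yes v∈A = v∈A
    ... | no  v∉A = contradiction le (<⇒≱ (≤-<-trans
      (card-≤ A (remove (_≟_ {n}) v xs) λ w w∈A →
        ∈-filter⁺ (λ x → ¬? (x ≟ v)) (sub w w∈A) λ { refl → v∉A w∈A })
      (length-remove (_≟_ {n}) v∈xs)))

    ⊆-card : ∀ (A B : DSet n) → (∀ v → v ∈ A → v ∈ B) → card B ≤ card A → ∀ {v} → v ∈ B → v ∈ A
    ⊆-card A B A⊆B le v∈B = ∈-elements⁻ A
      (full B (elements! A) (All.tabulate λ w∈ → A⊆B _ (∈-elements⁻ A w∈)) le v∈B)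

-- Boundaries, labellings and 3-connectedness

∂ : ∀ {n} → Graph n → DSet n → DSet n
∂ G P = ⟪ (λ v → ¬? (member? P v) ×-dec any? (λ u → member? P u ×-dec adj? G u v)) ⟫

exterior : ∀ {n} → Graph n → DSet n → DSet n
exterior G P = ⟪ (λ v → ¬? (member? P v) ×-dec ¬? (member? (∂ G P) v)) ⟫

Labelling : ℕ → ℕ → Set
Labelling n m = Fin n → Maybe (Fin m)

class : ∀ {n m} → Labelling n m → Fin m → DSet n
class c l = ⟪ (λ v → Maybe.≡-dec _≟_ (c v) (just l)) ⟫

off : ∀ {n m} → Labelling n m → DSet n
off c = ⟪ (λ v → Maybe.≡-dec _≟_ (c v) nothing) ⟫

Respects : ∀ {n m} → Graph n → Labelling n m → Set
Respects G c = ∀ {x y l l′} → Adj G x y → c x ≡ just l → c y ≡ just l′ → l ≡ l′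

-- Each class is a union of components off the cut, so toughness bounds the number of classes too.
-- `ls` may omit labels, which lets a label go out of use when two classes are merged.
Tough : ∀ {n} → Graph n → Set
Tough {n} G = ∀ {m} (c : Labelling n m) (ls : List (Fin m)) → Respects G c → Unique ls →
  (∀ {l} → l ∈ˡ ls → ∃ λ v → c v ≡ just l) → 2 ≤ length ls → 3 * length ls ≤ 2 * card (off c)

NoClaw : ∀ {n} → Graph n → Set
NoClaw G = ∀ {s a b c} → Adj G s a → Adj G s b → Adj G s c → a ≢ b → a ≢ c → b ≢ c →
  ¬ Adj G a b → ¬ Adj G a c → ¬ Adj G b c → ⊥

module _ {A : Set} (_≟ᴬ_ : (x y : A) → Dec (x ≡ y)) {P : Pred A 0ℓ} (P? : Decidable P)
         {xs : List A} (xs! : Unique xs) where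

  one-of : 0 < count P? xs → ∃ λ x → x ∈ˡ xs × P x
  one-of lt with count-pigeonhole _≟ᴬ_ P? {ys = []} xs! lt
  ... | x , x∈ , px , _ = x , x∈ , px

  two-of : 1 < count P? xs → ∃₂ λ x y → x ≢ y × (x ∈ˡ xs × P x) × (y ∈ˡ xs × P y)
  two-of lt with one-of (<-trans (s≤s z≤n) lt)
  ... | x , x∈ , px with count-pigeonhole _≟ᴬ_ P? {ys = x ∷ []} xs! lt
  ... | y , y∈ , py , y∉ = x , y , (λ { refl → y∉ (here refl) }) , (x∈ , px) , (y∈ , py)

  three-of : 2 < count P? xs → ∃₂ λ x y → ∃ λ z → (x ≢ y × x ≢ z × y ≢ z) ×
    (x ∈ˡ xs × P x) × (y ∈ˡ xs × P y) × (z ∈ˡ xs × P z)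
  three-of lt with two-of (<-trans (s≤s (s≤s z≤n)) lt)
  ... | x , y , x≢y , px , py with count-pigeonhole _≟ᴬ_ P? {ys = x ∷ y ∷ []} xs! lt
  ... | z , z∈ , pz , z∉ =
    x , y , z , (x≢y , (λ { refl → z∉ (here refl) }) , λ { refl → z∉ (there (here refl)) }) ,
    px , py , (z∈ , pz)

  at-most-two : ∀ {S : Set} (S? : Dec S) → (∀ {x} → P x → S) →
    (∀ {x y z} → x ≢ y → x ≢ z → y ≢ z → P x → P y → P z → ⊥) → count P? xs ≤ 2 * 𝟙 S?
  at-most-two (yes _) _ no-three = ≮⇒≥ λ lt →
    let _ , _ , _ , (≢₁ , ≢₂ , ≢₃) , (_ , p) , (_ , q) , (_ , r) = three-of lt
    in no-three ≢₁ ≢₂ ≢₃ p q r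
  at-most-two (no ¬s) P⇒S _ = ≮⇒≥ λ lt → ¬s (P⇒S (proj₂ (proj₂ (one-of lt))))

module Boundary {n} (G : Graph n) where

  ∂-step : ∀ P {u v} → u ∈ P → Adj G u v → v ∈ P ⊎ v ∈ ∂ G P
  ∂-step P {u} {v} u∈P uv with member? P v
  ... | yes v∈P = inj₁ v∈P
  ... | no  v∉P = inj₂ (v∉P , u , u∈P , uv)

  exterior-step : ∀ P {u v} → u ∈ exterior G P → Adj G u v → v ∉ P
  exterior-step P (u∉P , u∉∂) uv v∈P = u∉∂ (u∉P , _ , v∈P , symm G uv)

  ∂-exterior : ∀ P {v} → v ∈ ∂ G (exterior G P) → v ∈ ∂ G P
  ∂-exterior P {v} (v∉ext , u , u∈ext , uv) with member? P v
  ... | yes v∈P = contradiction v∈P (exterior-step P u∈ext uv)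
  ... | no  v∉P with member? (∂ G P) v
  ... | yes v∈∂ = v∈∂
  ... | no  v∉∂ = contradiction (v∉P , v∉∂) v∉ext

  N : Fin n → DSet n
  N v = ⟪ adj? G v ⟫

  -- Both unions and intersections of two sets have their boundaries inside ∂ A ∪ ∂ B,
  -- and a common boundary vertex lies in ∂ A ∩ ∂ B.
  ∂-submodular : ∀ A B → card (∂ G (A ∩ B)) + card (∂ G (A ∪ B)) ≤ card (∂ G A) + card (∂ G B)
  ∂-submodular A B = card-modular (∂ G (A ∩ B)) (∂ G (A ∪ B)) (∂ G A) (∂ G B) both either
    where
    both : ∀ v → v ∈ ∂ G (A ∩ B) → v ∈ ∂ G (A ∪ B) → v ∈ ∂ G A × v ∈ ∂ G B
    both v (_ , u , (u∈A , u∈B) , uv) (v∉ , _) =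
      (v∉ ∘ inj₁ , u , u∈A , uv) , (v∉ ∘ inj₂ , u , u∈B , uv)
    either : ∀ v → v ∈ ∂ G (A ∩ B) ⊎ v ∈ ∂ G (A ∪ B) → v ∈ ∂ G A ⊎ v ∈ ∂ G B
    either v (inj₁ (v∉ , u , (u∈A , u∈B) , uv)) with member? A v
    ... | yes v∈A = inj₂ ((λ v∈B → v∉ (v∈A , v∈B)) , u , u∈B , uv)
    ... | no  v∉A = inj₁ (v∉A , u , u∈A , uv)
    either v (inj₂ (v∉ , u , inj₁ u∈A , uv)) = inj₁ (v∉ ∘ inj₁ , u , u∈A , uv)
    either v (inj₂ (v∉ , u , inj₂ u∈B , uv)) = inj₂ (v∉ ∘ inj₂ , u , u∈B , uv)

module ToughGraph {n} (G : Graph n) (tough : Tough G) (noClaw : NoClaw G) where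
  open Boundary G
  open DecMembership (_≟_ {n}) using (_∈?_)

  module Separation (P : DSet n) (xs : List (Fin n)) where

    side : ∀ {v} → Dec (v ∈ P) → Dec (v ∈ˡ xs) → Maybe (Fin 2)
    side (yes _) _       = just zero
    side (no _)  (yes _) = nothing
    side (no _)  (no _)  = just (suc zero)

    sides : Labelling n 2
    sides v = side (member? P v) (v ∈? xs)

    in-P : ∀ {v} → v ∈ P → sides v ≡ just zero
    in-P {v} v∈P with member? P v
    ... | yes _   = refl
    ... | no  v∉P = contradiction v∈P v∉P

    away : ∀ {v} → v ∉ P → v ∉ˡ xs → sides v ≡ just (suc zero)
    away {v} v∉P v∉xs with member? P v | v ∈? xs
    ... | yes v∈P | _        = contradiction v∈P v∉P
    ... | no _    | yes v∈xs = contradiction v∈xs v∉xs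
    ... | no _    | no _     = refl

    off⊆ : ∀ v → v ∈ off sides → v ∈ˡ xs
    off⊆ v eq with member? P v | v ∈? xs
    off⊆ v () | yes _ | _
    off⊆ v eq | no _  | yes v∈xs = v∈xs
    off⊆ v () | no _  | no _

    respects : (∀ v → v ∈ ∂ G P → v ∈ˡ xs) → Respects G sides
    respects ∂⊆ {x} {y} xy p q with member? P x | x ∈? xs | member? P y | y ∈? xs
    respects ∂⊆ {x} {y} xy refl refl | yes _   | _       | yes _   | _       = refl
    respects ∂⊆ {x} {y} xy refl ()   | yes _   | _       | no _    | yes _
    respects ∂⊆ {x} {y} xy refl refl | yes x∈P | _       | no y∉P  | no y∉xs =
      contradiction (∂⊆ y (y∉P , x , x∈P , xy)) y∉xs
    respects ∂⊆ {x} {y} xy ()   q    | no _    | yes _   | _       | _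
    respects ∂⊆ {x} {y} xy refl refl | no x∉P  | no x∉xs | yes y∈P | _       =
      contradiction (∂⊆ x (x∉P , y , y∈P , symm G xy)) x∉xs
    respects ∂⊆ {x} {y} xy refl ()   | no _    | no _    | no _    | yes _
    respects ∂⊆ {x} {y} xy refl refl | no _    | no _    | no _    | no _    = refl

  -- Toughness for the two classes `P` and the rest, with cut inside `xs`, reads 3 · 2 ≤ 2 |cut|.
  3-connected : ∀ P xs {p o} → p ∈ P → o ∉ P → o ∉ˡ xs → (∀ v → v ∈ ∂ G P → v ∈ˡ xs) →
    3 ≤ length xs
  3-connected P xs {p} {o} p∈P o∉P o∉xs ∂⊆ = ≤-trans
    (*-cancelˡ-≤ 2 (tough sides (zero ∷ suc zero ∷ []) (respects ∂⊆)
      (((λ ()) ∷ []) ∷ [] ∷ []) attained ≤-refl))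
    (card-≤ (off sides) xs off⊆)
    where
    open Separation P xs
    attained : ∀ {l} → l ∈ˡ (zero ∷ suc zero ∷ []) → ∃ λ v → sides v ≡ just l
    attained {zero}     _ = p , in-P p∈P
    attained {suc zero} _ = o , away o∉P o∉xs

  3≤∂ : ∀ P {p o} → p ∈ P → o ∈ exterior G P → 3 ≤ card (∂ G P)
  3≤∂ P p∈P (o∉P , o∉∂) = 3-connected P (elements (∂ G P)) p∈P o∉P
    (o∉∂ ∘ ∈-elements⁻ (∂ G P)) (λ v → ∈-elements⁺ (∂ G P))

  module _ {m} (c : Labelling n m) (respects : Respects G c) where

    class-∂-off : ∀ {l s} → s ∈ ∂ G (class c l) → c s ≡ nothing
    class-∂-off {l} {s} (s∉ , u , cu , us) with c s in eq
    ... | nothing = refl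
    ... | just l′ = contradiction (cong just (sym (respects us cu eq))) s∉

    no-three-classes : ∀ {s l₁ l₂ l₃} → l₁ ≢ l₂ → l₁ ≢ l₃ → l₂ ≢ l₃ →
      s ∈ ∂ G (class c l₁) → s ∈ ∂ G (class c l₂) → s ∈ ∂ G (class c l₃) → ⊥
    no-three-classes l₁≢l₂ l₁≢l₃ l₂≢l₃ (_ , u₁ , c₁ , e₁) (_ , u₂ , c₂ , e₂) (_ , u₃ , c₃ , e₃) =
      noClaw (symm G e₁) (symm G e₂) (symm G e₃) (apart l₁≢l₂ c₁ c₂) (apart l₁≢l₃ c₁ c₃) (apart l₂≢l₃ c₂ c₃)
        (λ a → l₁≢l₂ (respects a c₁ c₂)) (λ a → l₁≢l₃ (respects a c₁ c₃)) (λ a → l₂≢l₃ (respects a c₂ c₃))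
      where
      apart : ∀ {l l′ u u′} → l ≢ l′ → c u ≡ just l → c u′ ≡ just l′ → u ≢ u′
      apart l≢l′ p q refl = l≢l′ (Maybe.just-injective (trans (sym p) q))

    other-class-exterior : ∀ {l l′ o} → l ≢ l′ → c o ≡ just l′ → o ∈ exterior G (class c l)
    other-class-exterior l≢l′ co =
      (λ p → l≢l′ (Maybe.just-injective (trans (sym p) co))) ,
      λ o∈∂ → contradiction (trans (sym co) (class-∂-off o∈∂)) λ ()

    -- The Matthews–Sumner count: a vertex meets at most two classes and every class has at
    -- least three neighbours, so 3 |ls| ≤ Σ |∂| ≤ 2 |off|.
    tight-classes : (ls : List (Fin m)) → Unique ls → (∀ {l} → l ∈ˡ ls → ∃ λ v → c v ≡ just l) →
      2 ≤ length ls → 2 * card (off c) ≤ 3 * length ls → ∀ {l} → l ∈ˡ ls → card (∂ G (class c l)) ≤ 3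
    tight-classes ls ls! attained 2≤ls tight {l} l∈ls with 4 ≤? card (∂ G (class c l))
    ... | no  ≱4 = s≤s⁻¹ (≰⇒> ≱4)
    ... | yes ≥4 = contradiction (≤-trans total tight) (<⇒≱ (weigh-> ls (All.tabulate least) l∈ls ≥4))
      where
      R? : ∀ k → Decidable (Member (∂ G (class c k)))
      R? k = member? (∂ G (class c k))

      least : ∀ {k} → k ∈ˡ ls → 3 ≤ card (∂ G (class c k))
      least {k} k∈ with attained k∈ | pigeonhole _≟_ {ys = k ∷ []} ls! 2≤ls
      ... | p , cp | k′ , k′∈ , k′∉ with attained k′∈
      ... | o , co = 3≤∂ (class c k) cp (other-class-exterior (λ { refl → k′∉ (here refl) }) co)

      bound : ∀ v → count (λ k → R? k v) ls ≤ 2 * 𝟙 (member? (off c) v) + 𝟙 (member? (∅ {n}) v)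
      bound v = ≤-trans (at-most-two _≟_ (λ k → R? k v) ls! (member? (off c) v)
        class-∂-off no-three-classes) (m≤m+n _ _)

      total : weigh (λ k → card (∂ G (class c k))) ls ≤ 2 * card (off c)
      total = subst (weigh (λ k → card (∂ G (class c k))) ls ≤_)
        (trans (cong (_+_ (2 * card (off c))) (n≤0⇒n≡0 (card-≤ (∅ {n}) [] λ _ ()))) (+-identityʳ _))
        (double-counting R? (member? (off c)) (member? (∅ {n})) ls bound (allFin n))

-- Critical edges

RespectsBut : ∀ {n m} → Graph n → Fin n → Fin n → Labelling n m → Set
RespectsBut G u v c = ∀ {x y l l′} → Adj G x y → c x ≡ just l → c y ≡ just l′ →
  l ≡ l′ ⊎ SameEdge u v x y

-- The labels are the components of G - uv off a cut of ratio below 3/2, seen as a labelling of `G`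
-- with one exceptional edge.
Critical : ∀ {n} → Graph n → Fin n → Fin n → Set
Critical {n} G u v = ∃ λ m → Σ (Labelling n m) λ c → RespectsBut G u v c ×
  (∀ l → ∃ λ w → c w ≡ just l) × 2 ≤ m × 2 * card (off c) < 3 * m

module Edges {n} (G : Graph n) (tough : Tough G) (noClaw : NoClaw G) where
  open Boundary G
  open ToughGraph G tough noClaw
  open DecMembership (_≟_ {n}) using (_∈?_)

  -- u and v are separated in G - uv by the at most two vertices of Z.
  record WeakSplit (u v : Fin n) : Set₁ where
    field
      A    : DSet n
      Z    : List (Fin n)
      ∣Z∣≤2 : length Z ≤ 2
      u∈A  : u ∈ A
      v∉A  : v ∉ A
      v∉Z  : v ∉ˡ Z
      Z∌A  : ∀ {z} → z ∈ˡ Z → z ∉ A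
      step : ∀ {a b} → a ∈ A → Adj G a b → b ∈ A ⊎ b ∈ˡ Z ⊎ (a ≡ u × b ≡ v)

    u∉Z : u ∉ˡ Z
    u∉Z u∈Z = Z∌A u∈Z u∈A

    B : DSet n
    B = ⟪ (λ w → ¬? (member? A w) ×-dec ¬? (w ∈? Z)) ⟫

    locate : ∀ w → w ∈ A ⊎ w ∈ˡ Z ⊎ w ∈ B
    locate w with member? A w | w ∈? Z
    ... | yes w∈A | _       = inj₁ w∈A
    ... | no _    | yes w∈Z = inj₂ (inj₁ w∈Z)
    ... | no w∉A  | no w∉Z  = inj₂ (inj₂ (w∉A , w∉Z))

    step-B : ∀ {a b} → a ∈ B → Adj G a b → b ∈ B ⊎ b ∈ˡ Z ⊎ (a ≡ v × b ≡ u)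
    step-B {a} {b} (a∉A , a∉Z) ab with locate b
    ... | inj₂ (inj₁ b∈Z) = inj₂ (inj₁ b∈Z)
    ... | inj₂ (inj₂ b∈B) = inj₁ b∈B
    ... | inj₁ b∈A with step b∈A (symm G ab)
    ... | inj₁ a∈A = contradiction a∈A a∉A
    ... | inj₂ (inj₁ a∈Z) = contradiction a∈Z a∉Z
    ... | inj₂ (inj₂ (b≡u , a≡v)) = inj₂ (inj₂ (a≡v , b≡u))

    -- The path through a common neighbour avoids the edge `uv`, so `Z` has to meet it.
    common∈Z : ∀ {w} → Adj G u w → Adj G v w → w ∈ˡ Z
    common∈Z {w} uw vw with step u∈A uw
    ... | inj₂ (inj₁ w∈Z) = w∈Z
    ... | inj₂ (inj₂ (_ , refl)) = contradiction vw (irrefl G refl)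
    ... | inj₁ w∈A with step w∈A (symm G vw)
    ... | inj₁ v∈A = contradiction v∈A v∉A
    ... | inj₂ (inj₁ v∈Z) = contradiction v∈Z v∉Z
    ... | inj₂ (inj₂ (refl , _)) = contradiction uw (irrefl G refl)

    ∂A⊆ : ∀ w → w ∈ ∂ G A → w ∈ˡ v ∷ Z
    ∂A⊆ w (w∉A , a , a∈A , aw) with step a∈A aw
    ... | inj₁ w∈A = contradiction w∈A w∉A
    ... | inj₂ (inj₁ w∈Z) = there w∈Z
    ... | inj₂ (inj₂ (_ , refl)) = here refl

    -- Dropping `u` trades `v` for `u` in the boundary.
    A-u : DSet n
    A-u = A ∖ fromList (u ∷ [])

    ∂A-u⊆ : ∀ w → w ∈ ∂ G A-u → w ∈ˡ u ∷ Z
    ∂A-u⊆ w (w∉ , a , (a∈A , a≢u) , aw) with step a∈A aw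
    ... | inj₂ (inj₁ w∈Z) = there w∈Z
    ... | inj₂ (inj₂ (refl , _)) = contradiction (here refl) a≢u
    ... | inj₁ w∈A with w ∈? (u ∷ [])
    ... | yes (here refl) = here refl
    ... | no w≢u = contradiction (w∈A , w≢u) w∉

  swapWeak : ∀ {u v} → WeakSplit u v → WeakSplit v u
  swapWeak s = record
    { A = B ; Z = Z ; ∣Z∣≤2 = ∣Z∣≤2 ; u∈A = v∉A , v∉Z ; v∉A = λ (u∉A , _) → u∉A u∈A
    ; v∉Z = u∉Z ; Z∌A = λ z∈Z (_ , z∉Z) → z∉Z z∈Z ; step = step-B }
    where open WeakSplit s

  -- Differs from the boundary of the class only in ignoring the opposite end of the exceptional
  -- edge, which is labelled.
  touch : ∀ {m} → Labelling n m → Fin m → DSet n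
  touch c l = ⟪ (λ s → member? (off c) s ×-dec any? (λ p → member? (class c l) p ×-dec adj? G p s)) ⟫

  -- A deficient cut of G - uv together with its classes; merging those of u and v gives a cut of G.
  record StrongSplit (u v : Fin n) : Set where
    field
      {m}       : ℕ
      c         : Labelling n m
      lu lv     : Fin m
      rest      : List (Fin m)
      lu≢lv     : lu ≢ lv
      cu        : c u ≡ just lu
      cv        : c v ≡ just lv
      rest!     : Unique rest
      lu∉rest   : lu ∉ˡ rest
      lv∉rest   : lv ∉ˡ rest
      covers    : ∀ {w l} → c w ≡ just l → l ∈ˡ lu ∷ lv ∷ rest
      attained  : ∀ {l} → l ∈ˡ rest → ∃ λ w → c w ≡ just l
      nonempty  : 1 ≤ length rest
      respects  : RespectsBut G u v c
      deficient : 2 * card (off c) < 3 * (2 + length rest)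
      3≤touch-u : 3 ≤ card (touch c lu)
      3≤touch-v : 3 ≤ card (touch c lv)

  -- Incidences of a single vertex: `a` and `b` for the classes of the two ends, `r` for the number
  -- of other classes it touches. A third incidence occurs only as 1 + 1 + 1, and `t` pays for it.
  𝟙-split : ∀ {A B O T : Set} (a : Dec A) (b : Dec B) (o : Dec O) (t : Dec T) (r : ℕ) →
    (A → O) → (B → O) → (0 < r → O) → (A → B → 0 < r → T) →
    (A → r ≤ 1) → (B → r ≤ 1) → r ≤ 2 → 𝟙 a + (𝟙 b + r) ≤ 2 * 𝟙 o + 𝟙 t
  𝟙-split (yes a) _ (no ¬o) _ _ A⇒O _ _ _ _ _ _ = contradiction (A⇒O a) ¬o
  𝟙-split (no _) (yes b) (no ¬o) _ _ _ B⇒O _ _ _ _ _ = contradiction (B⇒O b) ¬o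
  𝟙-split (no _) (no _) (no ¬o) _ 0 _ _ _ _ _ _ _ = z≤n
  𝟙-split (no _) (no _) (no ¬o) _ (suc r) _ _ r⇒O _ _ _ _ = contradiction (r⇒O (s≤s z≤n)) ¬o
  𝟙-split (yes a) (yes _) (yes _) (yes _) _ _ _ _ _ r≤1 _ _ = s≤s (s≤s (r≤1 a))
  𝟙-split (yes _) (yes _) (yes _) (no _) 0 _ _ _ _ _ _ _ = ≤-refl
  𝟙-split (yes a) (yes b) (yes _) (no ¬t) (suc r) _ _ _ T _ _ _ = contradiction (T a b (s≤s z≤n)) ¬t
  𝟙-split (yes a) (no _) (yes _) _ _ _ _ _ _ r≤1 _ _ = ≤-trans (s≤s (r≤1 a)) (m≤m+n 2 _)
  𝟙-split (no _) (yes b) (yes _) _ _ _ _ _ _ _ r≤1 _ = ≤-trans (s≤s (r≤1 b)) (m≤m+n 2 _)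
  𝟙-split (no _) (no _) (yes _) _ _ _ _ _ _ _ _ r≤2 = ≤-trans r≤2 (m≤m+n 2 _)

  -- Counting in a strong split

  module Split {u v} (uv : Adj G u v) (split : StrongSplit u v) where
    open StrongSplit split public

    end-label : ∀ {x l} → c x ≡ just l → x ≡ u ⊎ x ≡ v → l ∉ˡ rest
    end-label cx (inj₁ refl) l∈ = lu∉rest (subst (_∈ˡ rest) (Maybe.just-injective (trans (sym cx) cu)) l∈)
    end-label cx (inj₂ refl) l∈ = lv∉rest (subst (_∈ˡ rest) (Maybe.just-injective (trans (sym cx) cv)) l∈)

    -- Labels of `rest` never sit on `u` or `v`, so the exceptional edge cannot interfere.
    respects-rest : ∀ {x y l d} → d ∈ˡ rest → Adj G x y → c x ≡ just l → c y ≡ just d → l ≡ d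
    respects-rest d∈ xy cx cy with respects xy cx cy
    ... | inj₁ l≡d = l≡d
    ... | inj₂ (inj₁ (_ , y≡v)) = contradiction d∈ (end-label cy (inj₂ y≡v))
    ... | inj₂ (inj₂ (_ , y≡u)) = contradiction d∈ (end-label cy (inj₁ y≡u))

    apart : ∀ {l l′ x y} → l ≢ l′ → c x ≡ just l → c y ≡ just l′ → x ≢ y
    apart l≢l′ p q refl = l≢l′ (Maybe.just-injective (trans (sym p) q))

    -- The only pair of differently labelled adjacent vertices is uv, so three labels around s
    -- make a claw unless two of the neighbours are u and v.
    three-labels : ∀ {s p q r l l′ d} → d ∈ˡ rest → l ≢ l′ → l ≢ d → l′ ≢ d →
      Adj G p s → Adj G q s → Adj G r s → c p ≡ just l → c q ≡ just l′ → c r ≡ just d →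
      SameEdge u v p q
    three-labels {p = p} {q} d∈ l≢l′ l≢d l′≢d ps qs rs cp cq cr with adj? G p q
    ... | yes pq = [ (λ l≡l′ → contradiction l≡l′ l≢l′) , id ]′ (respects pq cp cq)
    ... | no ¬pq = ⊥-elim (noClaw (symm G ps) (symm G qs) (symm G rs)
      (apart l≢l′ cp cq) (apart l≢d cp cr) (apart l′≢d cq cr) ¬pq
      (λ pr → l≢d (respects-rest d∈ pr cp cr)) (λ qr → l′≢d (respects-rest d∈ qr cq cr)))

    ≢-rest : ∀ {l d} → l ∉ˡ rest → d ∈ˡ rest → l ≢ d
    ≢-rest l∉ d∈ refl = l∉ d∈

    -- At most one of the three labels belongs to an end of `uv`, so the exceptional edge cannot
    -- break the claw.
    two-rest : ∀ {s l d d′} → d ≢ d′ → l ≢ d → l ≢ d′ → d ∈ˡ rest → d′ ∈ˡ rest →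
      s ∈ touch c l → s ∈ touch c d → s ∈ touch c d′ → ⊥
    two-rest d≢d′ l≢d l≢d′ d∈ d′∈ (_ , p , cp , ps) (_ , q , cq , qs) (_ , r , cr , rs)
      with three-labels d′∈ l≢d l≢d′ d≢d′ ps qs rs cp cq cr
    ... | inj₁ (_ , q≡v) = end-label cq (inj₂ q≡v) d∈
    ... | inj₂ (_ , q≡u) = end-label cq (inj₁ q≡u) d∈

    -- `T` contains every vertex with three incidences. The vertices of `I` meet no third class and
    -- can leave the cut once the two classes are merged.
    Both T I : DSet n
    Both = touch c lu ∩ touch c lv
    T = ⟪ (λ s → member? Both s ×-dec Any.any? (λ d → member? (touch c d) s) rest) ⟫
    I = Both ∖ T

    ends : ∀ {s p q} → s ∈ T → c p ≡ just lu → Adj G p s → c q ≡ just lv → Adj G q s → p ≡ u × q ≡ v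
    ends (_ , third) cp ps cq qs with find third
    ... | d , d∈ , (_ , r , cr , rs)
      with three-labels d∈ lu≢lv (≢-rest lu∉rest d∈) (≢-rest lv∉rest d∈) ps qs rs cp cq cr
    ... | inj₁ same = same
    ... | inj₂ (refl , _) = contradiction (Maybe.just-injective (trans (sym cp) cv)) lu≢lv

    T-touch-u : ∀ {s p} → s ∈ T → c p ≡ just lu → Adj G p s → p ≡ u
    T-touch-u s∈T@((_ , _ , q , cq , qs) , _) cp ps = proj₁ (ends s∈T cp ps cq qs)

    T-touch-v : ∀ {s q} → s ∈ T → c q ≡ just lv → Adj G q s → q ≡ v
    T-touch-v s∈T@(((_ , p , cp , ps) , _) , _) cq qs = proj₂ (ends s∈T cp ps cq qs)

    T-adj-u : ∀ {s} → s ∈ T → Adj G u s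
    T-adj-u s∈T@(((_ , p , cp , ps) , _) , _) with T-touch-u s∈T cp ps
    ... | refl = ps

    T-adj-v : ∀ {s} → s ∈ T → Adj G v s
    T-adj-v s∈T@((_ , _ , q , cq , qs) , _) with T-touch-v s∈T cq qs
    ... | refl = qs

    T-third : ∀ {s} → s ∈ T → ∃₂ λ d w → d ∈ˡ rest × c w ≡ just d × Adj G w s
    T-third (_ , third) with find third
    ... | d , d∈ , (_ , w , cw , ws) = d , w , d∈ , cw , ws

    T-off : ∀ {s} → s ∈ T → c s ≡ nothing
    T-off (((off , _) , _) , _) = off

    common-off : ∀ {s} → Adj G u s → Adj G v s → c s ≡ nothing
    common-off {s} us vs with c s in cs
    ... | nothing = refl
    ... | just l with respects us cu cs | respects vs cv cs
    ... | inj₁ refl | inj₁ lv≡lu = contradiction (sym lv≡lu) lu≢lv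
    ... | inj₁ _ | inj₂ (inj₁ (_ , refl)) = contradiction vs (irrefl G refl)
    ... | inj₁ _ | inj₂ (inj₂ (_ , refl)) = contradiction us (irrefl G refl)
    ... | inj₂ (inj₁ (_ , refl)) | _ = contradiction vs (irrefl G refl)
    ... | inj₂ (inj₂ (_ , refl)) | _ = contradiction us (irrefl G refl)

    T-or-I : ∀ {s} → Adj G u s → Adj G v s → s ∈ T ⊎ s ∈ I
    T-or-I {s} us vs with member? T s
    ... | yes s∈T = inj₁ s∈T
    ... | no  s∉T = inj₂ (((common-off us vs , u , cu , us) , (common-off us vs , v , cv , vs)) , s∉T)

    ∂⊆touch : ∀ {d} → d ∈ˡ rest → ∀ s → s ∈ ∂ G (class c d) → s ∈ touch c d
    ∂⊆touch {d} d∈ s (s∉ , p , cp , ps) with c s in cs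
    ... | nothing = refl , p , cp , ps
    ... | just l = contradiction (cong just (respects-rest d∈ (symm G ps) cs cp)) s∉

    3≤touch : ∀ {d} → d ∈ˡ rest → 3 ≤ card (touch c d)
    3≤touch {d} d∈ with attained d∈
    ... | w , cw = ≤-trans (3≤∂ (class c d) {o = u} cw
      ((λ p → end-label p (inj₁ refl) d∈) , λ u∈∂ → contradiction (trans (sym cu) (proj₁ (∂⊆touch d∈ u u∈∂))) λ ()))
      (card-mono (∂ G (class c d)) (touch c d) (∂⊆touch d∈))

    incidences : card (touch c lu) + (card (touch c lv) + weigh (card ∘ touch c) rest) ≤
      2 * card (off c) + card T
    incidences = double-counting R? (member? (off c)) (member? T) (lu ∷ lv ∷ rest) bound (allFin n)
      where
      R? : ∀ l → Decidable (Member (touch c l))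
      R? l = member? (touch c l)

      bound : ∀ s → count (λ l → R? l s) (lu ∷ lv ∷ rest) ≤ 2 * 𝟙 (member? (off c) s) + 𝟙 (member? T s)
      bound s = subst (_≤ 2 * 𝟙 (member? (off c) s) + 𝟙 (member? T s)) (sym expand)
        (𝟙-split (R? lu s) (R? lv s) (member? (off c) s) (member? T s) (count S? rest)
          proj₁ proj₁ (λ lt → proj₁ (proj₂ (proj₂ (one-of _≟_ S? rest! lt))))
          third (at-most-one lu∉rest) (at-most-one lv∉rest) two)
        where
        S? : ∀ l → Dec (s ∈ touch c l)
        S? l = R? l s

        expand : count S? (lu ∷ lv ∷ rest) ≡ 𝟙 (R? lu s) + (𝟙 (R? lv s) + count S? rest)
        expand = trans (count-∷ S? lu (lv ∷ rest)) (cong (_+_ (𝟙 (R? lu s))) (count-∷ S? lv rest))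

        third : s ∈ touch c lu → s ∈ touch c lv → 0 < count S? rest → s ∈ T
        third su sv lt with one-of _≟_ S? rest! lt
        ... | d , d∈ , sd = (su , sv) , Any.map (λ { refl → sd }) d∈

        at-most-one : ∀ {l} → l ∉ˡ rest → s ∈ touch c l → count S? rest ≤ 1
        at-most-one l∉ sl = ≮⇒≥ λ lt →
          let d , d′ , d≢d′ , (d∈ , sd) , (d′∈ , sd′) = two-of _≟_ S? rest! lt
          in two-rest d≢d′ (≢-rest l∉ d∈) (≢-rest l∉ d′∈) d∈ d′∈ sl sd sd′

        two : count S? rest ≤ 2
        two = ≮⇒≥ λ lt →
          let _ , _ , _ , (≢₁ , ≢₂ , ≢₃) , (_ , sd) , (d′∈ , sd′) , (d″∈ , sd″) = three-of _≟_ S? rest! lt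
          in two-rest ≢₃ ≢₁ ≢₂ d′∈ d″∈ sd sd′ sd″

    private
      -- `k` is the excess of the incidences of `rest` over three per class. The 6 is the share of
      -- the two end classes in 3 (2 + r), and strictness comes from the deficiency.
      cancel : ∀ a b {w t s r} k → a + (b + w) ≤ s + t → suc s ≤ 3 * (2 + r) → k + 3 * r ≤ w →
        k + (a + b) < 6 + t
      cancel a b {w} {t} {s} {r} k le lt w≥ = +-cancelʳ-≤ (3 * r) _ _ (begin
        suc (k + (a + b)) + 3 * r   ≡⟨ e₁ k a b (3 * r) ⟩
        suc (a + (b + (k + 3 * r))) ≤⟨ s≤s (+-monoʳ-≤ a (+-monoʳ-≤ b w≥)) ⟩
        suc (a + (b + w))           ≤⟨ s≤s le ⟩
        suc s + t                   ≤⟨ +-monoˡ-≤ t lt ⟩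
        3 * (2 + r) + t             ≡⟨ e₂ r t ⟩
        6 + t + 3 * r               ∎)
        where
        open ≤-Reasoning
        e₁ : ∀ k a b r → suc (k + (a + b)) + r ≡ suc (a + (b + (k + r)))
        e₁ = solve-∀
        e₂ : ∀ r t → 3 * (2 + r) + t ≡ 6 + t + 3 * r
        e₂ = solve-∀

    touches-≤ : card (touch c lu) + card (touch c lv) ≤ 5 + card T
    touches-≤ = s≤s⁻¹ (cancel (card (touch c lu)) (card (touch c lv)) 0 incidences deficient
      (weigh-≥ rest (All.tabulate 3≤touch)))

    touches-≤′ : ∀ {d} → d ∈ˡ rest → 4 ≤ card (∂ G (class c d)) →
      card (touch c lu) + card (touch c lv) ≤ 4 + card T
    touches-≤′ {d} d∈ 4≤ = s≤s⁻¹ (s≤s⁻¹ (cancel (card (touch c lu)) (card (touch c lv)) 1 incidences deficient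
      (weigh-> rest (All.tabulate 3≤touch) d∈
        (≤-trans 4≤ (card-mono (∂ G (class c d)) (touch c d) (∂⊆touch d∈))))))

    -- The two end classes have at least six incidences, and `touches-≤` grants only five besides
    -- those paid for by `T`.
    T-nonempty : ∃ λ s → s ∈ T
    T-nonempty =
      let s , s∈T , _ = avoid T [] (+-cancelˡ-≤ 5 1 (card T) (≤-trans (+-mono-≤ 3≤touch-u 3≤touch-v) touches-≤))
      in s , s∈T

    near-u : ∀ {p} → Adj G u p → p ≡ v ⊎ c p ≡ just lu ⊎ p ∈ touch c lu
    near-u {p} up with c p in cp
    ... | nothing = inj₂ (inj₂ (refl , u , cu , up))
    ... | just l with respects up cu cp
    ... | inj₁ lu≡l = inj₂ (inj₁ (cong just (sym lu≡l)))
    ... | inj₂ (inj₁ (_ , p≡v)) = inj₁ p≡v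
    ... | inj₂ (inj₂ (_ , refl)) = contradiction up (irrefl G refl)

    near-v : ∀ {p} → Adj G v p → p ≡ u ⊎ c p ≡ just lv ⊎ p ∈ touch c lv
    near-v {p} vp with c p in cp
    ... | nothing = inj₂ (inj₂ (refl , v , cv , vp))
    ... | just l with respects vp cv cp
    ... | inj₁ lv≡l = inj₂ (inj₁ (cong just (sym lv≡l)))
    ... | inj₂ (inj₁ (_ , refl)) = contradiction vp (irrefl G refl)
    ... | inj₂ (inj₂ (_ , p≡u)) = inj₁ p≡u

    -- The class of w minus w has w and neighbours outside T as its only boundary, so by
    -- 3-connectedness it is empty or there are two of the latter.
    two-more : ∀ {w l o} → (∀ {s} → s ∈ T → s ∈ touch c l) →
      (∀ {s p} → s ∈ T → c p ≡ just l → Adj G p s → p ≡ w) →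
      (∀ {a b} → c a ≡ just l → a ≢ w → Adj G a b → c b ≡ just l ⊎ b ∈ touch c l) →
      c o ≢ just l → c o ≢ nothing → ∀ {p} → c p ≡ just l → p ≢ w → 2 + card T ≤ card (touch c l)
    two-more {w} {l} {o} T⊆ only leaves o≢l o≢nothing {p} cp p≢w = s≤s⁻¹ (begin
      3 + card T                                 ≤⟨ +-monoˡ-≤ (card T)
        (3≤∂ P {o = o} (cp , p≢w ∘ Any.singleton⁻) (o≢l ∘ proj₁ , o∉∂)) ⟩
      card (∂ G P) + card T                      ≤⟨ card-modular (∂ G P) T (fromList (w ∷ [])) (touch c l) both either ⟩
      card (fromList (w ∷ [])) + card (touch c l) ≤⟨ +-monoˡ-≤ (card (touch c l))
        (card-≤ (fromList (w ∷ [])) (w ∷ []) (λ _ → id)) ⟩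
      1 + card (touch c l)                       ∎)
      where
      open ≤-Reasoning
      P : DSet n
      P = class c l ∖ fromList (w ∷ [])

      o∉∂ : o ∉ ∂ G P
      o∉∂ (_ , a , (ca , a≢w) , ao) = [ o≢l , o≢nothing ∘ proj₁ ]′ (leaves ca (a≢w ∘ here) ao)

      both : ∀ s → s ∈ ∂ G P → s ∈ T → s ∈ fromList (w ∷ []) × s ∈ touch c l
      both s (_ , a , (ca , a≢w) , as) s∈T = contradiction (here (only s∈T ca as)) a≢w

      either : ∀ s → s ∈ ∂ G P ⊎ s ∈ T → s ∈ fromList (w ∷ []) ⊎ s ∈ touch c l
      either s (inj₂ s∈T) = inj₂ (T⊆ s∈T)
      either s (inj₁ (s∉P , a , (ca , a≢w) , as)) with leaves ca (a≢w ∘ here) as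
      ... | inj₂ s∈touch = inj₂ s∈touch
      ... | inj₁ cs with s ∈? (w ∷ [])
      ... | yes s≡w = inj₁ s≡w
      ... | no s≢w = contradiction (cs , s≢w) s∉P

    leaves-u : ∀ {a b} → c a ≡ just lu → a ≢ u → Adj G a b → c b ≡ just lu ⊎ b ∈ touch c lu
    leaves-u {a} {b} ca a≢u ab with c b in cb
    ... | nothing = inj₂ (refl , a , ca , ab)
    ... | just l with respects ab ca cb
    ... | inj₁ lu≡l = inj₁ (cong just (sym lu≡l))
    ... | inj₂ (inj₁ (a≡u , _)) = contradiction a≡u a≢u
    ... | inj₂ (inj₂ (refl , _)) = contradiction (Maybe.just-injective (trans (sym ca) cv)) lu≢lv

    leaves-v : ∀ {a b} → c a ≡ just lv → a ≢ v → Adj G a b → c b ≡ just lv ⊎ b ∈ touch c lv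
    leaves-v {a} {b} ca a≢v ab with c b in cb
    ... | nothing = inj₂ (refl , a , ca , ab)
    ... | just l with respects ab ca cb
    ... | inj₁ lv≡l = inj₁ (cong just (sym lv≡l))
    ... | inj₂ (inj₁ (refl , _)) = contradiction (Maybe.just-injective (trans (sym cu) ca)) lu≢lv
    ... | inj₂ (inj₂ (a≡v , _)) = contradiction a≡v a≢v

    module _ (few : card (touch c lu) + card (touch c lv) ≤ 4 + card T) where

      -- A second vertex in the class would raise the sum to (2 + |T|) + 3.
      lone-u : ∀ {p} → c p ≡ just lu → p ≡ u
      lone-u {p} cp with p ≟ u
      ... | yes p≡u = p≡u
      ... | no  p≢u = contradiction few (<⇒≱ (subst (_≤ card (touch c lu) + card (touch c lv))
        (+-comm (2 + card T) 3)
        (+-mono-≤ (two-more {u} {lu} {v} (proj₁ ∘ proj₁) T-touch-u leaves-u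
          (λ eq → lu≢lv (Maybe.just-injective (trans (sym eq) cv)))
          (λ eq → contradiction (trans (sym cv) eq) λ ()) cp p≢u) 3≤touch-v)))

      lone-v : ∀ {p} → c p ≡ just lv → p ≡ v
      lone-v {p} cp with p ≟ v
      ... | yes p≡v = p≡v
      ... | no  p≢v = contradiction few (<⇒≱
        (+-mono-≤ 3≤touch-u (two-more {v} {lv} {u} (proj₂ ∘ proj₁) T-touch-v leaves-v
          (λ eq → lu≢lv (Maybe.just-injective (trans (sym cu) eq)))
          (λ eq → contradiction (trans (sym cu) eq) λ ()) cp p≢v)))

    -- The merged class. A neighbour of `I` with a label in `rest` would put its vertex into `T`, so
    -- `I` can be included and the cut shrinks by `|I|`.
    E : DSet n
    E = (class c lu ∪ class c lv) ∪ I

    module Merge where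
      relabel : ∀ {v} → Dec (v ∈ E) → Maybe (Fin m)
      relabel (yes _)    = just lu
      relabel {v} (no _) = c v

      merged : Labelling n m
      merged v = relabel (member? E v)

      merged-E : ∀ {v} → v ∈ E → merged v ≡ just lu
      merged-E {v} v∈E with member? E v
      ... | yes _   = refl
      ... | no  v∉E = contradiction v∈E v∉E

      merged-¬E : ∀ {v} → v ∉ E → merged v ≡ c v
      merged-¬E {v} v∉E with member? E v
      ... | yes v∈E = contradiction v∈E v∉E
      ... | no _    = refl

      rest∉E : ∀ {v d} → d ∈ˡ rest → c v ≡ just d → v ∉ E
      rest∉E d∈ cv (inj₁ (inj₁ p)) = ≢-rest lu∉rest d∈ (Maybe.just-injective (trans (sym p) cv))
      rest∉E d∈ cv (inj₁ (inj₂ p)) = ≢-rest lv∉rest d∈ (Maybe.just-injective (trans (sym p) cv))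
      rest∉E d∈ cv (inj₂ (((off , _) , _) , _)) = contradiction (trans (sym off) cv) λ ()

      label-∉E : ∀ {v l} → v ∉ E → c v ≡ just l → l ∈ˡ rest
      label-∉E v∉E cv with covers cv
      ... | here refl          = contradiction (inj₁ (inj₁ cv)) v∉E
      ... | there (here refl)  = contradiction (inj₁ (inj₂ cv)) v∉E
      ... | there (there l∈)   = l∈

      E-closed : ∀ {x y d} → x ∈ E → d ∈ˡ rest → c y ≡ just d → ¬ Adj G x y
      E-closed (inj₁ (inj₁ cx)) d∈ cy xy = ≢-rest lu∉rest d∈ (respects-rest d∈ xy cx cy)
      E-closed (inj₁ (inj₂ cx)) d∈ cy xy = ≢-rest lv∉rest d∈ (respects-rest d∈ xy cx cy)
      E-closed (inj₂ (both , x∉T)) d∈ cy xy =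
        x∉T (both , Any.map (λ { refl → proj₁ (proj₁ both) , _ , cy , symm G xy }) d∈)

      merged-respects : Respects G merged
      merged-respects {x} {y} xy p q with member? E x | member? E y
      ... | yes _ | yes _ = Maybe.just-injective (trans (sym p) q)
      ... | yes x∈E | no y∉E = contradiction xy (E-closed x∈E (label-∉E y∉E q) q)
      ... | no x∉E | yes y∈E = contradiction (symm G xy) (E-closed y∈E (label-∉E x∉E p) p)
      ... | no x∉E | no y∉E = respects-rest (label-∉E y∉E q) xy p q

      merged-off : ∀ {v} → v ∈ off merged → v ∉ E × c v ≡ nothing
      merged-off {v} eq with member? E v
      merged-off {v} () | yes _
      merged-off {v} eq | no v∉E = v∉E , eq

      offs : card (off merged) + card I ≤ card (off c)
      offs = subst (card (off merged) + card I ≤_)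
        (trans (cong (_+_ (card (off c))) (n≤0⇒n≡0 (card-≤ (∅ {n}) [] λ _ ()))) (+-identityʳ _))
        (card-modular (off merged) I (off c) ∅
          (λ v o v∈I → contradiction (inj₂ v∈I) (proj₁ (merged-off o)))
          (λ v → [ inj₁ ∘ proj₂ ∘ merged-off , (λ (((off , _) , _) , _) → inj₁ off) ]′))

      labels : List (Fin m)
      labels = lu ∷ rest

      labels! : Unique labels
      labels! = All.tabulate (λ l∈ → λ { refl → lu∉rest l∈ }) ∷ rest!

      merged-attained : ∀ {l} → l ∈ˡ labels → ∃ λ w → merged w ≡ just l
      merged-attained (here refl) = u , merged-E (inj₁ (inj₁ cu))
      merged-attained (there l∈) with attained l∈
      ... | w , cw = w , trans (merged-¬E (rest∉E l∈ cw)) cw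

      enough : 3 * length labels ≤ 2 * card (off merged)
      enough = tough merged labels merged-respects labels! merged-attained (s≤s nonempty)

      spare : 2 * card (off merged) + 2 * card I < 6 + 3 * length rest
      spare = begin-strict
        2 * card (off merged) + 2 * card I ≡⟨ *-distribˡ-+ 2 (card (off merged)) (card I) ⟨
        2 * (card (off merged) + card I)   ≤⟨ *-monoʳ-≤ 2 offs ⟩
        2 * card (off c)                   <⟨ deficient ⟩
        3 * (2 + length rest)              ≡⟨ *-distribˡ-+ 3 2 (length rest) ⟩
        6 + 3 * length rest                ∎
        where open ≤-Reasoning

      -- The merged cut satisfies 3 (1 + r) ≤ 2|off| - 2|I|, while 2|off| ≤ 5 + 3r; this leaves 2|I|
      -- ≤ 2.
      ∣I∣≤1 : card I ≤ 1
      ∣I∣≤1 = s≤s⁻¹ (*-cancelˡ-< 2 (card I) 2 (≤-trans (+-cancelˡ-≤ (3 * length rest) (suc (2 * card I)) 3 (begin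
        3 * length rest + suc (2 * card I)         ≡⟨ +-suc _ _ ⟩
        suc (3 * length rest + 2 * card I)         ≤⟨ +-cancelˡ-≤ 3 _ _ (begin
          3 + suc (3 * length rest + 2 * card I)   ≡⟨ arrange (length rest) (card I) ⟩
          suc (3 * length labels + 2 * card I)     ≤⟨ s≤s (+-monoˡ-≤ (2 * card I) enough) ⟩
          suc (2 * card (off merged) + 2 * card I) ≤⟨ spare ⟩
          3 + (3 + 3 * length rest)                ∎) ⟩
        3 + 3 * length rest                        ≡⟨ +-comm 3 _ ⟩
        3 * length rest + 3                        ∎)) (m≤m+n 3 1)))
        where
        open ≤-Reasoning
        arrange : ∀ r i → 3 + suc (3 * r + 2 * i) ≡ suc (3 * suc r + 2 * i)
        arrange = solve-∀

      module _ {s} (s∈I : s ∈ I) where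

        -- One vertex in `I` consumes the whole slack, so the merged cut has ratio exactly 3/2 and
        -- `tight-classes` applies to `E` and to every class of `rest`.
        merged-tight : 2 * card (off merged) ≤ 3 * length labels
        merged-tight = +-cancelˡ-≤ 3 _ _ (begin
          3 + 2 * card (off merged)                ≡⟨ cong suc (+-comm 2 (2 * card (off merged))) ⟩
          suc (2 * card (off merged) + 2 * 1)      ≤⟨ s≤s (+-monoʳ-≤ (2 * card (off merged))
            (*-monoʳ-≤ 2 (card-≥ I ([] ∷ []) (s∈I ∷ [])))) ⟩
          suc (2 * card (off merged) + 2 * card I) ≤⟨ spare ⟩
          6 + 3 * length rest                      ≡⟨ cong (_+_ 3) (*-suc 3 (length rest)) ⟨
          3 + 3 * length labels                    ∎)
          where open ≤-Reasoning

        tight-labels : ∀ {l} → l ∈ˡ labels → card (∂ G (class merged l)) ≤ 3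
        tight-labels = tight-classes merged merged-respects labels labels! merged-attained
          (s≤s nonempty) merged-tight

        only-I : ∀ {s′} → s′ ∈ I → s′ ≡ s
        only-I s′∈I = Any.singleton⁻ (full I ([] ∷ []) (s∈I ∷ []) ∣I∣≤1 s′∈I)

        ∂E≤3 : card (∂ G E) ≤ 3
        ∂E≤3 = ≤-trans (card-mono (∂ G E) (∂ G (class merged lu)) λ w (w∉E , p , p∈E , pw) →
          (λ eq → lu∉rest (label-∉E w∉E (trans (sym (merged-¬E w∉E)) eq))) , p , merged-E p∈E , pw)
          (tight-labels (here refl))

        ∂rest≤3 : ∀ {d} → d ∈ˡ rest → card (∂ G (class c d)) ≤ 3
        ∂rest≤3 {d} d∈ = ≤-trans (card-mono (∂ G (class c d)) (∂ G (class merged d)) λ w (w∉ , p , cp , pw) →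
          (λ eq → w∉ (keep eq)) , p , trans (merged-¬E (rest∉E d∈ cp)) cp , pw) (tight-labels (there d∈))
          where
          keep : ∀ {w} → merged w ≡ just d → c w ≡ just d
          keep {w} eq with member? E w
          ... | yes _ = contradiction (Maybe.just-injective eq) (≢-rest lu∉rest d∈)
          ... | no _  = eq

-- From a critical edge to a weak or a strong split

module CriticalEdges {n} (G : Graph n) (tough : Tough G) (noClaw : NoClaw G) where
  open Boundary G
  open ToughGraph G tough noClaw
  open Edges G tough noClaw

  module _ {m} (c : Labelling n m) (onto : ∀ l → ∃ λ w → c w ≡ just l) where

    weakSplit : ∀ {u v lu} → RespectsBut G u v c → c u ≡ just lu → c v ≢ just lu → c v ≢ nothing →
      card (touch c lu) ≤ 2 → WeakSplit u v
    weakSplit {u} {v} {lu} respects cu cv≢ cv≢nothing few = record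
      { A = class c lu
      ; Z = elements (touch c lu)
      ; ∣Z∣≤2 = few
      ; u∈A = cu
      ; v∉A = cv≢
      ; v∉Z = λ v∈ → cv≢nothing (proj₁ (∈-elements⁻ (touch c lu) v∈))
      ; Z∌A = λ z∈ cz → contradiction (trans (sym (proj₁ (∈-elements⁻ (touch c lu) z∈))) cz) λ ()
      ; step = step
      }
      where
      step : ∀ {a b} → c a ≡ just lu → Adj G a b →
        c b ≡ just lu ⊎ b ∈ˡ elements (touch c lu) ⊎ (a ≡ u × b ≡ v)
      step {a} {b} ca ab with c b in cb
      ... | nothing = inj₂ (inj₁ (∈-elements⁺ (touch c lu) (cb , a , ca , ab)))
      ... | just l with respects ab ca cb
      ... | inj₁ lu≡l = inj₁ (cong just (sym lu≡l))
      ... | inj₂ (inj₁ e) = inj₂ (inj₂ e)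
      ... | inj₂ (inj₂ (refl , _)) = contradiction ca cv≢

    module _ {u v} (respects : RespectsBut G u v c) (2≤m : 2 ≤ m) (deficient : 2 * card (off c) < 3 * m) where

      -- Otherwise `uv` respects the labels as well, and toughness of `G` contradicts the
      -- deficiency.
      ends-differ : ¬ (∀ {lu lv} → c u ≡ just lu → c v ≡ just lv → lu ≡ lv)
      ends-differ same = <⇒≱ deficient (subst (λ k → 3 * k ≤ 2 * card (off c)) len
        (tough c (allFin m) respectsAll (Unique.allFin⁺ m) (λ {l} _ → onto l) (subst (2 ≤_) (sym len) 2≤m)))
        where
        len : length (allFin m) ≡ m
        len = length-tabulate id
        respectsAll : Respects G c
        respectsAll xy cx cy with respects xy cx cy
        ... | inj₁ eq = eq
        ... | inj₂ (inj₁ (refl , refl)) = same cx cy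
        ... | inj₂ (inj₂ (refl , refl)) = sym (same cy cx)

      module _ {lu lv} (cu : c u ≡ just lu) (cv : c v ≡ just lv) (lu≢lv : lu ≢ lv)
               (3≤u : 3 ≤ card (touch c lu)) (3≤v : 3 ≤ card (touch c lv)) where
        open DecMembership (_≟_ {m}) using (_∈?_)

        others : List (Fin m)
        others = filter (λ l → ¬? (l ∈? (lu ∷ lv ∷ []))) (allFin m)

        others∌ : ∀ {l} → l ∈ˡ others → l ∉ˡ lu ∷ lv ∷ []
        others∌ l∈ = proj₂ (∈-filter⁻ (λ l → ¬? (l ∈? (lu ∷ lv ∷ []))) {xs = allFin m} l∈)

        all-labels : ∀ l → l ∈ˡ lu ∷ lv ∷ others
        all-labels l with l ∈? (lu ∷ lv ∷ [])
        ... | yes (here eq)         = here eq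
        ... | yes (there (here eq)) = there (here eq)
        ... | no l∉ = there (there (∈-filter⁺ (λ l → ¬? (l ∈? (lu ∷ lv ∷ []))) (∈-allFin l) l∉))

        m≤ : m ≤ 2 + length others
        m≤ = subst (_≤ 2 + length others) (length-tabulate id)
          (length-⊆ _≟_ (Unique.allFin⁺ m) (λ {l} _ → all-labels l))

        deficient′ : 2 * card (off c) < 3 * (2 + length others)
        deficient′ = <-≤-trans deficient (*-monoʳ-≤ 3 m≤)

        -- Three touched cut vertices give 6 ≤ 2|off| < 3m, so there are at least three labels.
        some-other : 1 ≤ length others
        some-other = +-cancelˡ-< 2 0 (length others) (*-cancelˡ-< 3 2 (2 + length others) (≤-<-trans
          (*-monoʳ-≤ 2 (≤-trans 3≤u (card-mono (touch c lu) (off c) (λ _ → proj₁)))) deficient′))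

        strongSplit : StrongSplit u v
        strongSplit = record
          { c = c ; lu = lu ; lv = lv ; rest = others ; lu≢lv = lu≢lv ; cu = cu ; cv = cv
          ; rest! = Unique.filter⁺ (λ l → ¬? (l ∈? (lu ∷ lv ∷ []))) (Unique.allFin⁺ m)
          ; lu∉rest = λ l∈ → others∌ l∈ (here refl)
          ; lv∉rest = λ l∈ → others∌ l∈ (there (here refl))
          ; covers = λ {_} {l} _ → all-labels l
          ; attained = λ {l} _ → onto l
          ; nonempty = some-other
          ; respects = respects
          ; deficient = deficient′
          ; 3≤touch-u = 3≤u
          ; 3≤touch-v = 3≤v }

      splitting : WeakSplit u v ⊎ StrongSplit u v
      splitting with c u in cu | c v in cv
      ... | nothing | _       = ⊥-elim (ends-differ λ p _ → contradiction (trans (sym cu) p) λ ())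
      ... | just _  | nothing = ⊥-elim (ends-differ λ _ p → contradiction (trans (sym cv) p) λ ())
      ... | just lu | just lv with lu ≟ lv
      ... | yes refl = ⊥-elim (ends-differ
        λ p q → Maybe.just-injective (trans (trans (sym p) cu) (trans (sym cv) q)))
      ... | no lu≢lv with 3 ≤? card (touch c lu) | 3 ≤? card (touch c lv)
      ... | no ≱3 | _ = inj₁ (weakSplit respects cu
              (λ p → lu≢lv (Maybe.just-injective (trans (sym p) cv)))
              (λ p → contradiction (trans (sym cv) p) λ ()) (s≤s⁻¹ (≰⇒> ≱3)))
      ... | yes _ | no ≱3 = inj₁ (swapWeak (weakSplit
              (λ xy p q → [ inj₁ , inj₂ ∘ [ inj₂ , inj₁ ]′ ]′ (respects xy p q)) cv
              (λ p → lu≢lv (Maybe.just-injective (trans (sym cu) p)))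
              (λ p → contradiction (trans (sym cu) p) λ ()) (s≤s⁻¹ (≰⇒> ≱3))))
      ... | yes 3≤u | yes 3≤v = inj₂ (strongSplit cu cv lu≢lv 3≤u 3≤v)

  critical-split : ∀ {u v} → Critical G u v → WeakSplit u v ⊎ StrongSplit u v
  critical-split (_ , c , respects , onto , 2≤m , deficient) = splitting c onto respects 2≤m deficient

-- Smallest fragments

module MinimalFragment {n} (G : Graph n) (tough : Tough G) (noClaw : NoClaw G)
  (4≤degree : ∀ v → 4 ≤ card (Boundary.N G v))
  (critical : ∀ {u v} → Adj G u v → Critical G u v)
  (F : DSet n) (∂F≤3 : card (∂ G F) ≤ 3)
  {p₀ o₀} (p₀∈F : p₀ ∈ F) (o₀∈F̄ : o₀ ∈ exterior G F)
  (minimal : ∀ P {p o} → p ∈ P → o ∈ exterior G P → card (∂ G P) ≤ 3 → card F ≤ card P)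
  where
  open Boundary G
  open ToughGraph G tough noClaw
  open Edges G tough noClaw
  open CriticalEdges G tough noClaw
  open DecMembership (_≟_ {n}) using (_∈?_)

  X F̄ : DSet n
  X = ∂ G F
  F̄ = exterior G F

  locate : ∀ v → v ∈ F ⊎ v ∈ X ⊎ v ∈ F̄
  locate v with member? F v | member? X v
  ... | yes v∈F | _       = inj₁ v∈F
  ... | no _    | yes v∈X = inj₂ (inj₁ v∈X)
  ... | no v∉F  | no v∉X  = inj₂ (inj₂ (v∉F , v∉X))

  F≢X : ∀ {f x} → f ∈ F → x ∈ X → f ≢ x
  F≢X f∈F x∈X refl = proj₁ x∈X f∈F

  F≢F̄ : ∀ {f r} → f ∈ F → r ∈ F̄ → f ≢ r
  F≢F̄ f∈F r∈F̄ refl = proj₁ r∈F̄ f∈F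

  X≢F̄ : ∀ {x r} → x ∈ X → r ∈ F̄ → x ≢ r
  X≢F̄ x∈X r∈F̄ refl = proj₂ r∈F̄ x∈X

  F≁F̄ : ∀ {f r} → f ∈ F → r ∈ F̄ → ¬ Adj G f r
  F≁F̄ f∈F r∈F̄ fr = exterior-step F r∈F̄ (symm G fr) f∈F

  near-F : ∀ {f v} → f ∈ F → Adj G f v → v ∈ F ⊎ v ∈ X
  near-F = ∂-step F

  3≤∣X∣ : 3 ≤ card X
  3≤∣X∣ = 3≤∂ F p₀∈F o₀∈F̄

  -- `P` is a fragment inside `F`, since `o₀` has no neighbour in `F`; minimality leaves no room for
  -- a proper subset.
  shrink : ∀ P xs {p} → (∀ v → v ∈ P → v ∈ F) → p ∈ P → (∀ v → v ∈ ∂ G P → v ∈ˡ xs) →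
    length xs ≤ 3 → ∀ {g} → g ∈ F → g ∈ P
  shrink P xs P⊆F p∈P ∂⊆ le = ⊆-card P F P⊆F (minimal P p∈P
    ((λ o∈P → proj₁ o₀∈F̄ (P⊆F _ o∈P)) , λ (_ , u , u∈P , uo) → F≁F̄ (P⊆F u u∈P) o₀∈F̄ uo)
    (≤-trans (card-≤ (∂ G P) xs ∂⊆) le))

  -- `o` is exterior to `F ∪ Q`, whose boundary therefore has at least three vertices. Submodularity
  -- leaves at most three for `F ∩ Q`, which by minimality is all of `F`.
  uncross : ∀ Q {u o} → u ∈ F → u ∈ Q → card (∂ G Q) ≤ 3 → o ∈ F̄ → o ∈ exterior G Q →
    ∀ {g} → g ∈ F → g ∈ Q
  uncross Q {u} {o} u∈F u∈Q ∂Q≤3 (o∉F , o∉X) (o∉Q , o∉∂Q) g∈F =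
    proj₂ (⊆-card (F ∩ Q) F (λ _ → proj₁) (minimal (F ∩ Q) (u∈F , u∈Q) o∈ext∩ ∂∩≤3) g∈F)
    where
    o∈ext∩ : o ∈ exterior G (F ∩ Q)
    o∈ext∩ = o∉F ∘ proj₁ , λ (_ , w , (w∈F , _) , wo) → o∉X (o∉F , w , w∈F , wo)
    o∈ext∪ : o ∈ exterior G (F ∪ Q)
    o∈ext∪ = [ o∉F , o∉Q ]′ , λ
      { (_ , w , inj₁ w∈F , wo) → o∉X (o∉F , w , w∈F , wo)
      ; (_ , w , inj₂ w∈Q , wo) → o∉∂Q (o∉Q , w , w∈Q , wo) }
    ∂∩≤3 : card (∂ G (F ∩ Q)) ≤ 3
    ∂∩≤3 = +-cancelʳ-≤ 3 _ _ (≤-trans (+-monoʳ-≤ (card (∂ G (F ∩ Q))) (3≤∂ (F ∪ Q) (inj₁ u∈F) o∈ext∪))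
      (≤-trans (∂-submodular F Q) (+-mono-≤ ∂F≤3 ∂Q≤3)))

  exterior-exterior : ∀ P {v} → v ∈ P → v ∈ exterior G (exterior G P)
  exterior-exterior P v∈P = (λ v∈ext → proj₁ v∈ext v∈P) , λ v∈∂ → proj₁ (∂-exterior P v∈∂) v∈P

  ∂-exterior≤3 : ∀ P → card (∂ G P) ≤ 3 → card (∂ G (exterior G P)) ≤ 3
  ∂-exterior≤3 P = ≤-trans (card-mono (∂ G (exterior G P)) (∂ G P) λ _ → ∂-exterior P)

  -- `F̄` is a fragment too: its boundary lies in `X`, and `F` lies in its exterior.
  ∣F∣≤∣F̄∣ : card F ≤ card F̄
  ∣F∣≤∣F̄∣ = minimal F̄ o₀∈F̄ (exterior-exterior F p₀∈F) (∂-exterior≤3 F ∂F≤3)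

  2≤∣F∣ : 2 ≤ card F
  2≤∣F∣ = ≮⇒≥ λ lt → <⇒≱ (≤-trans (4≤degree p₀) (card-mono (N p₀) X λ v pv →
    [ (λ v∈F → contradiction (symm G pv)
        (irrefl G (Any.singleton⁻ (full F ([] ∷ []) (p₀∈F ∷ []) (s≤s⁻¹ lt) v∈F))))
    , (λ v∈X → v∈X) ]′ (near-F p₀∈F pv))) ∂F≤3

  another : ∀ f → ∃ λ f′ → f′ ∈ F × f′ ≢ f
  another f = let f′ , f′∈F , f′∉ = avoid F (f ∷ []) 2≤∣F∣ in f′ , f′∈F , f′∉ ∘ here

  corners : ∀ {x} → x ∈ X → ∃₂ λ y z → (y ∈ X × z ∈ X) × (x ≢ y × x ≢ z × y ≢ z) ×
    (∀ {v} → v ∈ X → v ∈ˡ x ∷ y ∷ z ∷ [])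
  corners {x} x∈X =
    let y , y∈X , y∉ = avoid X (x ∷ []) (≤-trans (s≤s (s≤s z≤n)) 3≤∣X∣)
        z , z∈X , z∉ = avoid X (x ∷ y ∷ []) 3≤∣X∣
        x≢y = λ eq → y∉ (here (sym eq))
        x≢z = λ eq → z∉ (here (sym eq))
        y≢z = λ eq → z∉ (there (here (sym eq)))
    in y , z , (y∈X , z∈X) , (x≢y , x≢z , y≢z) ,
       full X ((x≢y ∷ x≢z ∷ []) ∷ (y≢z ∷ []) ∷ [] ∷ []) (x∈X ∷ y∈X ∷ z∈X ∷ []) ∂F≤3

  -- Otherwise the other two vertices of `X` would separate `F̄` from `F`.
  neighbour-F̄ : ∀ {x} → x ∈ X → ∃ λ r → r ∈ F̄ × Adj G x r
  neighbour-F̄ {x} x∈X with any? (λ r → member? F̄ r ×-dec adj? G x r)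
  ... | yes found = found
  ... | no none = let y , z , (y∈X , z∈X) , _ , X⊆ = corners x∈X in
    contradiction (3-connected F̄ (y ∷ z ∷ []) {o = p₀} o₀∈F̄ (λ p₀∈F̄ → proj₁ p₀∈F̄ p₀∈F)
      (λ { (here eq) → F≢X p₀∈F y∈X eq ; (there (here eq)) → F≢X p₀∈F z∈X eq })
      (boundary X⊆)) λ { (s≤s (s≤s ())) }
    where
    boundary : ∀ {y z} → (∀ {v} → v ∈ X → v ∈ˡ x ∷ y ∷ z ∷ []) → ∀ v → v ∈ ∂ G F̄ → v ∈ˡ y ∷ z ∷ []
    boundary X⊆ v v∈∂@(_ , u , u∈F̄ , uv) with X⊆ (∂-exterior F v∈∂)
    ... | here refl = contradiction (u , u∈F̄ , symm G uv) none
    ... | there v∈  = v∈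

  -- Otherwise `f` could replace `x` in the boundary, and `F` without `f`, nonempty because `2≤∣F∣`,
  -- would be a smaller fragment.
  neighbour-F : ∀ {x f} → x ∈ X → f ∈ F → ∃ λ f′ → f′ ∈ F × Adj G x f′ × f′ ≢ f
  neighbour-F {x} {f} x∈X f∈F with any? (λ g → member? F g ×-dec adj? G x g ×-dec ¬? (g ≟ f))
  ... | yes found = found
  ... | no none = let y , z , _ , _ , X⊆ = corners x∈X; g , g∈F , g≢f = another f in
    contradiction (here refl) (proj₂ (shrink (F ∖ fromList (f ∷ [])) (f ∷ y ∷ z ∷ []) (λ _ → proj₁)
      (g∈F , g≢f ∘ Any.singleton⁻) (boundary X⊆) ≤-refl f∈F))
    where
    boundary : ∀ {y z} → (∀ {v} → v ∈ X → v ∈ˡ x ∷ y ∷ z ∷ []) →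
      ∀ v → v ∈ ∂ G (F ∖ fromList (f ∷ [])) → v ∈ˡ f ∷ y ∷ z ∷ []
    boundary X⊆ v (v∉ , u , (u∈F , u≢f) , uv) with v ≟ f
    ... | yes refl = here refl
    ... | no v≢f with near-F u∈F uv
    ... | inj₁ v∈F = contradiction (v∈F , v≢f ∘ Any.singleton⁻) v∉
    ... | inj₂ v∈X with X⊆ v∈X
    ... | here refl = contradiction (u , u∈F , symm G uv , λ { refl → u≢f (here refl) }) none
    ... | there v∈  = there v∈

  -- A neighbour of `x` in `F̄` would complete a claw.
  clique : ∀ {x f g} → x ∈ X → f ∈ F → g ∈ F → Adj G x f → Adj G x g → f ≢ g → Adj G f g
  clique {x} {f} {g} x∈X f∈F g∈F xf xg f≢g with adj? G f g
  ... | yes fg = fg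
  ... | no ¬fg = let r , r∈F̄ , xr = neighbour-F̄ x∈X in
    ⊥-elim (noClaw xf xg xr f≢g (F≢F̄ f∈F r∈F̄) (F≢F̄ g∈F r∈F̄) ¬fg (F≁F̄ f∈F r∈F̄) (F≁F̄ g∈F r∈F̄))

  ∂≤3 : ∀ P Z w → length Z ≤ 2 → (∀ v → v ∈ ∂ G P → v ∈ˡ w ∷ Z) → card (∂ G P) ≤ 3
  ∂≤3 P Z w ∣Z∣≤2 ∂⊆ = ≤-trans (card-≤ (∂ G P) (w ∷ Z) ∂⊆) (s≤s ∣Z∣≤2)

  no-three : ∀ {Z : List (Fin n)} {a b c} → length Z ≤ 2 → a ≢ b → a ≢ c → b ≢ c →
    a ∈ˡ Z → b ∈ˡ Z → c ∈ˡ Z → ⊥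
  no-three ∣Z∣≤2 a≢b a≢c b≢c a∈ b∈ c∈ = <⇒≱ (length-⊆ _≟_
    ((a≢b ∷ a≢c ∷ []) ∷ (b≢c ∷ []) ∷ [] ∷ [])
    λ { (here refl) → a∈ ; (there (here refl)) → b∈ ; (there (there (here refl))) → c∈ }) ∣Z∣≤2

  -- A second neighbour `f′` of `x` in `F` is adjacent to `f`, hence in `Z`, and uncrossing then
  -- confines `A` to `X`. Degree four gives `x` a neighbour `y` in `A`; now `Z` contains `f′`, a
  -- neighbour of `x` in `F̄` and a neighbour of `y` in `F` other than `f′`.
  no-weak-boundary : ∀ {x f} → x ∈ X → f ∈ F → Adj G x f → ¬ WeakSplit x f
  no-weak-boundary {x} {f} x∈X f∈F xf split =
    let f′ , f′∈F , xf′ , f′≢f = neighbour-F x∈X f∈F in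
    go f′∈F xf′ f′≢f (common∈Z xf′ (clique x∈X f∈F f′∈F xf xf′ (f′≢f ∘ sym)))
    where
    open WeakSplit split hiding (locate)
    module Swapped = WeakSplit (swapWeak split)

    F̄∩A=∅ : ∀ {f′ o} → f′ ∈ F → f′ ∈ˡ Z → o ∈ F̄ → o ∉ A
    F̄∩A=∅ f′∈F f′∈Z o∈F̄ o∈A = proj₂ (uncross B f∈F (v∉A , v∉Z) (∂≤3 B Z x ∣Z∣≤2 Swapped.∂A⊆) o∈F̄
      ((λ o∈B → proj₁ o∈B o∈A) , λ o∈∂B → case (Swapped.∂A⊆ _ o∈∂B)) f′∈F) f′∈Z
      where
      case : _ ∉ˡ x ∷ Z
      case (here refl) = X≢F̄ x∈X o∈F̄ refl
      case (there o∈Z) = Z∌A o∈Z o∈A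

    F̄∩B=∅ : ∀ {g o} → g ∈ F → g ∈ A → o ∈ F̄ → o ∉ B
    F̄∩B=∅ {g} g∈F g∈A o∈F̄ (o∉A , o∉Z) = v∉A (proj₁ (uncross A-u g∈F
      (g∈A , F≢X g∈F x∈X ∘ Any.singleton⁻) (∂≤3 A-u Z x ∣Z∣≤2 ∂A-u⊆) o∈F̄
      (o∉A ∘ proj₁ , λ o∈∂ → case (∂A-u⊆ _ o∈∂)) f∈F))
      where
      case : _ ∉ˡ x ∷ Z
      case (here refl) = X≢F̄ x∈X o∈F̄ refl
      case (there o∈Z) = o∉Z o∈Z

    F∩A=∅ : ∀ {f′ g} → f′ ∈ F → f′ ∈ˡ Z → g ∈ F → g ∉ A
    F∩A=∅ {f′} f′∈F f′∈Z g∈F g∈A = <⇒≱ (≤-trans (s≤s (≤-trans 2≤∣F∣ ∣F∣≤∣F̄∣))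
      (length-⊆ _≟_ {xs = f′ ∷ elements F̄} {ys = Z}
        (All.tabulate (λ r∈ → F≢F̄ f′∈F (∈-elements⁻ F̄ r∈)) ∷ elements! F̄)
        λ { (here refl) → f′∈Z ; (there o∈) → F̄⊆Z (∈-elements⁻ F̄ o∈) })) ∣Z∣≤2
      where
      F̄⊆Z : ∀ {o} → o ∈ F̄ → o ∈ˡ Z
      F̄⊆Z {o} o∈F̄ with WeakSplit.locate split o
      ... | inj₁ o∈A = contradiction o∈A (F̄∩A=∅ f′∈F f′∈Z o∈F̄)
      ... | inj₂ (inj₁ o∈Z) = o∈Z
      ... | inj₂ (inj₂ o∈B) = contradiction o∈B (F̄∩B=∅ g∈F g∈A o∈F̄)

    go : ∀ {f′} → f′ ∈ F → Adj G x f′ → f′ ≢ f → f′ ∈ˡ Z → ⊥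
    go {f′} f′∈F xf′ f′≢f f′∈Z =
      let y , xy , y∉ = avoid (N x) (f ∷ Z) (≤-trans (s≤s (s≤s ∣Z∣≤2)) (4≤degree x))
          y∈A = inA xy y∉
          y∈X = inX y∈A
          r , r∈F̄ , xr = neighbour-F̄ x∈X
          g , g∈F , yg , g≢f′ = neighbour-F y∈X f′∈F
      in no-three ∣Z∣≤2 (F≢F̄ f′∈F r∈F̄) (g≢f′ ∘ sym) (F≢F̄ g∈F r∈F̄ ∘ sym)
           f′∈Z (r∈Z r∈F̄ xr) (g∈Z y∈A (λ y≡x → irrefl G (sym y≡x) xy) g∈F yg)
      where
      inA : ∀ {y} → Adj G x y → y ∉ˡ f ∷ Z → y ∈ A
      inA xy y∉ with step u∈A xy
      ... | inj₁ y∈A = y∈A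
      ... | inj₂ (inj₁ y∈Z) = contradiction (there y∈Z) y∉
      ... | inj₂ (inj₂ (_ , y≡f)) = contradiction (here y≡f) y∉

      inX : ∀ {y} → y ∈ A → y ∈ X
      inX {y} y∈A with locate y
      ... | inj₁ y∈F = contradiction y∈A (F∩A=∅ f′∈F f′∈Z y∈F)
      ... | inj₂ (inj₁ y∈X) = y∈X
      ... | inj₂ (inj₂ y∈F̄) = contradiction y∈A (F̄∩A=∅ f′∈F f′∈Z y∈F̄)

      r∈Z : ∀ {r} → r ∈ F̄ → Adj G x r → r ∈ˡ Z
      r∈Z r∈F̄ xr with step u∈A xr
      ... | inj₁ r∈A = contradiction r∈A (F̄∩A=∅ f′∈F f′∈Z r∈F̄)
      ... | inj₂ (inj₁ r∈Z) = r∈Z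
      ... | inj₂ (inj₂ (_ , refl)) = contradiction refl (F≢F̄ f∈F r∈F̄)

      g∈Z : ∀ {y g} → y ∈ A → y ≢ x → g ∈ F → Adj G y g → g ∈ˡ Z
      g∈Z y∈A y≢x g∈F yg with step y∈A yg
      ... | inj₁ g∈A = contradiction g∈A (F∩A=∅ f′∈F f′∈Z g∈F)
      ... | inj₂ (inj₁ g∈Z) = g∈Z
      ... | inj₂ (inj₂ (y≡x , _)) = contradiction y≡x y≢x

  -- An exterior vertex on one side lets the opposite side be uncrossed with `F`, which puts `u` and
  -- `v` on the same side. Hence `F̄` fits into `Z`, which is too small for it.
  no-weak-inside : ∀ {u v} → 3 ≤ card F → u ∈ F → v ∈ F → ¬ WeakSplit u v
  no-weak-inside {u} {v} 3≤∣F∣ u∈F v∈F split =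
    <⇒≱ (≤-trans (≤-trans 3≤∣F∣ ∣F∣≤∣F̄∣) (card-≤ F̄ (WeakSplit.Z split) F̄⊆Z)) (WeakSplit.∣Z∣≤2 split)
    where
    F̄∩B=∅ : ∀ {u v o} (s : WeakSplit u v) → u ∈ F → v ∈ F → o ∈ F̄ → o ∉ WeakSplit.B s
    F̄∩B=∅ {u} {v} s u∈F v∈F o∈F̄ (o∉A , o∉Z) = v∉A (uncross A u∈F u∈A (∂≤3 A Z v ∣Z∣≤2 ∂A⊆) o∈F̄
      (o∉A , λ o∈∂ → case (∂A⊆ _ o∈∂)) v∈F)
      where
      open WeakSplit s
      case : _ ∉ˡ v ∷ Z
      case (here refl) = F≢F̄ v∈F o∈F̄ refl
      case (there o∈Z) = o∉Z o∈Z

    F̄⊆Z : ∀ o → o ∈ F̄ → o ∈ˡ WeakSplit.Z split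
    F̄⊆Z o o∈F̄ with WeakSplit.locate split o
    ... | inj₁ o∈A = contradiction ((λ (o∉A , _) → o∉A o∈A) , λ o∈Z → WeakSplit.Z∌A split o∈Z o∈A)
                       (F̄∩B=∅ (swapWeak split) v∈F u∈F o∈F̄)
    ... | inj₂ (inj₁ o∈Z) = o∈Z
    ... | inj₂ (inj₂ o∈B) = contradiction o∈B (F̄∩B=∅ split u∈F v∈F o∈F̄)

  -- A set with a 3-vertex boundary that misses x and f cannot cut F, by uncrossing.
  pinned : ∀ D {p x f f′ s} → card (∂ G D) ≤ 3 → p ∈ D → x ∈ X → x ∈ exterior G D →
    f ∈ F → f ∈ exterior G D → f′ ∈ F → f′ ≢ f → f′ ∉ D → s ∈ ∂ G D → s ∉ F̄ →
    s ∉ F × ∃ λ o → o ∈ F̄ × o ∈ D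
  pinned D {p} {x} {f} {f′} {s} ∂D≤3 p∈D x∈X (x∉D , x∉∂D) f∈F (f∉D , f∉∂D) f′∈F f′≢f f′∉D s∈∂D s∉F̄
    with any? (λ o → member? F̄ o ×-dec member? D o)
  ... | yes (o , o∈F̄ , o∈D) = (λ s∈F → proj₂ (uncross (exterior G D) f∈F (f∉D , f∉∂D)
          (∂-exterior≤3 D ∂D≤3) o∈F̄ (exterior-exterior D o∈D) s∈F) s∈∂D) , o , o∈F̄ , o∈D
  ... | no none = ⊥-elim contra
    where
    -- Either `F̄` has a vertex exterior to `D` and uncrossing puts `f′` into `D`, or `F̄` lies in
    -- the boundary of `D`, which has at least four vertices together with `s`.
    F∩D=∅ : ∀ {g} → g ∈ F → g ∉ D
    F∩D=∅ {g} g∈F g∈D with any? (λ o → member? F̄ o ×-dec member? (exterior G D) o)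
    ... | yes (o , o∈F̄ , o∈D̄) = f′∉D (uncross D g∈F g∈D ∂D≤3 o∈F̄ o∈D̄ f′∈F)
    ... | no none′ = <⇒≱ (≤-trans (s≤s (≤-trans 3≤∣F∣ ∣F∣≤∣F̄∣)) (card-≥ (∂ G D) {s ∷ elements F̄}
        (All.tabulate (λ { r∈ refl → s∉F̄ (∈-elements⁻ F̄ r∈) }) ∷ elements! F̄)
        (s∈∂D ∷ All.tabulate (λ r∈ → F̄⊆∂D (∈-elements⁻ F̄ r∈))))) ∂D≤3
      where
      3≤∣F∣ : 3 ≤ card F
      3≤∣F∣ = card-≥ F ((f′≢f ∷ (λ { refl → f′∉D g∈D }) ∷ []) ∷ ((λ { refl → f∉D g∈D }) ∷ []) ∷ [] ∷ [])
        (f′∈F ∷ f∈F ∷ g∈F ∷ [])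
      F̄⊆∂D : ∀ {o} → o ∈ F̄ → o ∈ ∂ G D
      F̄⊆∂D {o} o∈F̄ with member? (∂ G D) o
      ... | yes o∈∂D = o∈∂D
      ... | no  o∉∂D = contradiction (o , o∈F̄ , (λ o∈D → none (o , o∈F̄ , o∈D)) , o∉∂D) none′

    D⊆X : ∀ {y} → y ∈ D → y ∈ X
    D⊆X {y} y∈D with locate y
    ... | inj₁ y∈F = contradiction y∈D (F∩D=∅ y∈F)
    ... | inj₂ (inj₁ y∈X) = y∈X
    ... | inj₂ (inj₂ y∈F̄) = contradiction (y , y∈F̄ , y∈D) none

    to-∂D : ∀ {y v} → y ∈ D → Adj G y v → v ∈ F ⊎ v ∈ F̄ → v ∈ ∂ G D
    to-∂D y∈D yv v∈ with ∂-step D y∈D yv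
    ... | inj₂ v∈∂D = v∈∂D
    ... | inj₁ v∈D  = contradiction v∈D ([ F∩D=∅ , (λ v∈F̄ v∈D → none (_ , v∈F̄ , v∈D)) ]′ v∈)

    2≤∣D∣ : 2 ≤ card D
    2≤∣D∣ = ≮⇒≥ λ lt → <⇒≱ (≤-trans (4≤degree p) (card-mono (N p) (∂ G D) λ v pv →
      [ (λ v∈D → contradiction (symm G pv) (irrefl G (Any.singleton⁻ (full D ([] ∷ []) (p∈D ∷ []) (s≤s⁻¹ lt) v∈D))))
      , (λ v∈∂D → v∈∂D) ]′ (∂-step D p∈D pv))) ∂D≤3

    X⊆ : ∀ {q} → q ∈ D → q ≢ p → ∀ {v} → v ∈ X → v ∈ˡ x ∷ p ∷ q ∷ []
    X⊆ q∈D q≢p = full X (((λ { refl → x∉D p∈D }) ∷ (λ { refl → x∉D q∈D }) ∷ []) ∷ ((q≢p ∘ sym) ∷ []) ∷ [] ∷ [])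
      (x∈X ∷ D⊆X p∈D ∷ D⊆X q∈D ∷ []) ∂F≤3

    ∂D∩F̄ : ∀ {g g′ r o} → g ∈ F → g′ ∈ F → g′ ≢ g → r ∈ F̄ → g ∈ ∂ G D → g′ ∈ ∂ G D → r ∈ ∂ G D →
      o ∈ F̄ → o ∈ ∂ G D → o ≡ r
    ∂D∩F̄ g∈F g′∈F g′≢g r∈F̄ g∈ g′∈ r∈ o∈F̄ o∈ = case
      (full (∂ G D) (((g′≢g ∘ sym) ∷ F≢F̄ g∈F r∈F̄ ∷ []) ∷ (F≢F̄ g′∈F r∈F̄ ∷ []) ∷ [] ∷ [])
        (g∈ ∷ g′∈ ∷ r∈ ∷ []) ∂D≤3 o∈)
      where
      case : _ → _
      case (here refl) = contradiction refl (F≢F̄ g∈F o∈F̄)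
      case (there (here refl)) = contradiction refl (F≢F̄ g′∈F o∈F̄)
      case (there (there (here o≡r))) = o≡r

    -- By now `D` consists of `p` and `q`, the vertices of `X` other than `x`. Two neighbours of `p`
    -- in `F` and one, `r`, in `F̄` exhaust the boundary of `D`, so `r` and `x` alone cut off the
    -- rest of `F̄`.
    contra : ⊥
    contra =
      let q , q∈D , q∉ = avoid D (p ∷ []) 2≤∣D∣
          g , g∈F , pg , _ = neighbour-F (D⊆X p∈D) p₀∈F
          g′ , g′∈F , pg′ , g′≢g = neighbour-F (D⊆X p∈D) g∈F
          r , r∈F̄ , pr = neighbour-F̄ (D⊆X p∈D)
          r′ , r′∈F̄ , r′∉ = avoid F̄ (r ∷ []) (≤-trans 2≤∣F∣ ∣F∣≤∣F̄∣)
          unique-r = λ {o} → ∂D∩F̄ {o = o} g∈F g′∈F g′≢g r∈F̄ (to-∂D p∈D pg (inj₁ g∈F))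
            (to-∂D p∈D pg′ (inj₁ g′∈F)) (to-∂D p∈D pr (inj₂ r∈F̄))
      in contradiction (3-connected (F̄ ∖ fromList (r ∷ [])) (r ∷ x ∷ []) {o = p₀} (r′∈F̄ , r′∉)
           (λ p₀∈ → proj₁ (proj₁ p₀∈) p₀∈F)
           (λ { (here eq) → F≢F̄ p₀∈F r∈F̄ eq ; (there (here eq)) → F≢X p₀∈F x∈X eq })
           (boundary (X⊆ q∈D (λ eq → q∉ (here eq))) q∈D unique-r)) λ { (s≤s (s≤s ())) }
      where
      boundary : ∀ {q r} → (∀ {v} → v ∈ X → v ∈ˡ x ∷ p ∷ q ∷ []) → q ∈ D →
        (∀ {o} → o ∈ F̄ → o ∈ ∂ G D → o ≡ r) →
        ∀ v → v ∈ ∂ G (F̄ ∖ fromList (r ∷ [])) → v ∈ˡ r ∷ x ∷ []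
      boundary {q} {r} X⊆ q∈D unique-r v (v∉ , u , (u∈F̄ , u≢r) , uv) with locate v
      ... | inj₁ v∈F = contradiction (symm G uv) (F≁F̄ v∈F u∈F̄)
      ... | inj₂ (inj₂ v∈F̄) with v ≟ r
      ... | yes refl = here refl
      ... | no  v≢r  = contradiction (v∈F̄ , v≢r ∘ Any.singleton⁻) v∉
      boundary {q} {r} X⊆ q∈D unique-r v (v∉ , u , (u∈F̄ , u≢r) , uv) | inj₂ (inj₁ v∈X) with X⊆ v∈X
      ... | here refl = there (here refl)
      ... | there (here refl) = contradiction (here (unique-r u∈F̄ (to-∂D p∈D (symm G uv) (inj₂ u∈F̄)))) u≢r
      ... | there (there (here refl)) = contradiction (here (unique-r u∈F̄ (to-∂D q∈D (symm G uv) (inj₂ u∈F̄)))) u≢r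

  adjacent-pair : ∀ {g g′} → g ∈ F → (∀ {v} → v ∈ F → v ∈ˡ g ∷ g′ ∷ []) →
    Adj G g g′ × (∀ {x} → x ∈ X → Adj G g x)
  adjacent-pair {g} {g′} g∈F F⊆ = fill (here refl) , λ x∈X → fill (there (∈-elements⁺ X x∈X))
    where
    N⊆ : ∀ v → v ∈ N g → v ∈ˡ g′ ∷ elements X
    N⊆ v gv with near-F g∈F gv
    ... | inj₂ v∈X = there (∈-elements⁺ X v∈X)
    ... | inj₁ v∈F with F⊆ v∈F
    ... | here refl = contradiction gv (irrefl G refl)
    ... | there (here refl) = here refl
    fill : ∀ {v} → v ∈ˡ g′ ∷ elements X → Adj G g v
    fill = saturate (N g) (g′ ∷ elements X) N⊆ (≤-trans (s≤s ∂F≤3) (4≤degree g))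

  -- Fragments with two vertices

  module Pair {f f′} (f∈F : f ∈ F) (f′∈F : f′ ∈ F) (f≢f′ : f ≢ f′)
              (F⊆ : ∀ {v} → v ∈ F → v ∈ˡ f ∷ f′ ∷ []) where

    F⊆′ : ∀ {v} → v ∈ F → v ∈ˡ f′ ∷ f ∷ []
    F⊆′ v∈F with F⊆ v∈F
    ... | here eq = there (here eq)
    ... | there (here eq) = here eq

    ff′ : Adj G f f′
    ff′ = proj₁ (adjacent-pair f∈F F⊆)

    fX : ∀ {x} → x ∈ X → Adj G f x
    fX = proj₂ (adjacent-pair f∈F F⊆)

    f′X : ∀ {x} → x ∈ X → Adj G f′ x
    f′X = proj₂ (adjacent-pair f′∈F F⊆′)

    -- `Z` is exactly the common neighbours `f` and `f′`, which have no neighbour in `F̄`. So `y`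
    -- alone would cut off the rest of its side; that rest is empty, and `y` has degree at most
    -- three.
    no-weak-pair : ∀ {x y z} → x ∈ X → y ∈ X → (∀ {v} → v ∈ X → v ∈ˡ x ∷ y ∷ z ∷ []) →
      (s : WeakSplit x y) → z ∉ WeakSplit.A s
    no-weak-pair {x} {y} {z} x∈X y∈X X⊆ s z∈A = <⇒≱ (4≤degree y)
      (card-≤ (N y) (x ∷ f ∷ f′ ∷ []) N⊆)
      where
      open WeakSplit s hiding (locate)
      module Swapped = WeakSplit (swapWeak s)

      f∈Z : f ∈ˡ Z
      f∈Z = common∈Z (symm G (fX x∈X)) (symm G (fX y∈X))

      f′∈Z : f′ ∈ˡ Z
      f′∈Z = common∈Z (symm G (f′X x∈X)) (symm G (f′X y∈X))

      Z⊆ : ∀ {w} → w ∈ˡ Z → w ∈ˡ f ∷ f′ ∷ []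
      Z⊆ {w} w∈Z with w ≟ f | w ≟ f′
      ... | yes eq | _ = here eq
      ... | no _ | yes eq = there (here eq)
      ... | no w≢f | no w≢f′ = ⊥-elim (no-three ∣Z∣≤2 f≢f′ (w≢f ∘ sym) (w≢f′ ∘ sym) f∈Z f′∈Z w∈Z)

      Z⊆F : ∀ {w} → w ∈ˡ Z → w ∈ F
      Z⊆F w∈Z with Z⊆ w∈Z
      ... | here refl = f∈F
      ... | there (here refl) = f′∈F

      B-y⊆F̄ : ∀ {b} → b ∈ Swapped.A-u → b ∈ F̄
      B-y⊆F̄ {b} ((b∉A , b∉Z) , b≢y) with locate b
      ... | inj₂ (inj₂ b∈F̄) = b∈F̄
      ... | inj₁ b∈F with F⊆ b∈F
      ... | here refl = contradiction f∈Z b∉Z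
      ... | there (here refl) = contradiction f′∈Z b∉Z
      B-y⊆F̄ {b} ((b∉A , b∉Z) , b≢y) | inj₂ (inj₁ b∈X) with X⊆ b∈X
      ... | here refl = contradiction u∈A b∉A
      ... | there (here refl) = contradiction (here refl) b≢y
      ... | there (there (here refl)) = contradiction z∈A b∉A

      B⊆y : ∀ {b} → b ∈ B → b ≡ y
      B⊆y {b} b∈B with b ≟ y
      ... | yes eq = eq
      ... | no b≢y = contradiction (3-connected Swapped.A-u (y ∷ []) {o = x} (b∈B , b≢y ∘ Any.singleton⁻)
        (λ x∈ → proj₁ (proj₁ x∈) u∈A) (λ { (here refl) → v∉A u∈A }) boundary) λ { (s≤s ()) }
        where
        boundary : ∀ w → w ∈ ∂ G Swapped.A-u → w ∈ˡ y ∷ []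
        boundary w w∈∂@(_ , a , a∈ , aw) with Swapped.∂A-u⊆ w w∈∂
        ... | here eq = here eq
        ... | there w∈Z = contradiction (symm G aw) (F≁F̄ (Z⊆F w∈Z) (B-y⊆F̄ a∈))

      N⊆ : ∀ w → Adj G y w → w ∈ˡ x ∷ f ∷ f′ ∷ []
      N⊆ w yw with step-B (v∉A , v∉Z) yw
      ... | inj₁ w∈B = contradiction yw (irrefl G (sym (B⊆y w∈B)))
      ... | inj₂ (inj₁ w∈Z) = there (Z⊆ w∈Z)
      ... | inj₂ (inj₂ (_ , w≡x)) = here w≡x

    module StrongBoundary {x} (x∈X : x ∈ X) (strong : StrongSplit x f) where
      open Split (symm G (fX x∈X)) strong

      -- Every neighbour of `f′` is `f` or a neighbour of `f`, and neither carries a label of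
      -- `rest`.
      f′∉T : f′ ∉ T
      f′∉T f′∈T = case (T-third f′∈T)
        where
        case : ¬ (∃₂ λ d w → d ∈ˡ rest × c w ≡ just d × Adj G w f′)
        case (d , w , d∈ , cw , wf′) = end (near-F f′∈F (symm G wf′))
          where
          adjacent : ¬ Adj G f w
          adjacent fw = lv∉rest (subst (_∈ˡ rest) (sym (respects-rest d∈ fw cv cw)) d∈)
          end : ¬ (w ∈ F ⊎ w ∈ X)
          end (inj₂ w∈X) = adjacent (fX w∈X)
          end (inj₁ w∈F) with F⊆ w∈F
          ... | here refl = end-label cw (inj₂ refl) d∈
          ... | there (here refl) = irrefl G refl wf′

      T⊆X : ∀ {s} → s ∈ T → s ∈ X
      T⊆X s∈T with near-F f∈F (T-adj-v s∈T)
      ... | inj₂ s∈X = s∈X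
      ... | inj₁ s∈F with F⊆ s∈F
      ... | here refl = contradiction (T-adj-v s∈T) (irrefl G refl)
      ... | there (here refl) = contradiction s∈T f′∉T

      neighbour : ∃ λ y → y ∈ X × Adj G x y
      neighbour = let s , s∈T = T-nonempty in s , T⊆X s∈T , T-adj-u s∈T

    X-neighbour : ∀ {x} → x ∈ X → ∃ λ y → y ∈ X × Adj G x y
    X-neighbour x∈X = [ (λ weak → ⊥-elim (no-weak-boundary x∈X f∈F (symm G (fX x∈X)) weak))
      , StrongBoundary.neighbour x∈X ]′ (critical-split (critical (symm G (fX x∈X))))

    module Edge {x y z} (x∈X : x ∈ X) (y∈X : y ∈ X) (z∈X : z ∈ X)
      (X⊆ : ∀ {v} → v ∈ X → v ∈ˡ x ∷ y ∷ z ∷ []) (xy : Adj G x y) where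

      X⊆′ : ∀ {v} → v ∈ X → v ∈ˡ y ∷ x ∷ z ∷ []
      X⊆′ v∈X with X⊆ v∈X
      ... | here eq = there (here eq)
      ... | there (here eq) = here eq
      ... | there (there p) = there (there p)

      not-weak : ¬ WeakSplit x y
      not-weak weak with WeakSplit.locate weak z
      ... | inj₁ z∈A = no-weak-pair x∈X y∈X X⊆ weak z∈A
      ... | inj₂ (inj₁ z∈Z) = no-three (WeakSplit.∣Z∣≤2 weak) f≢f′ (F≢X f∈F z∈X) (F≢X f′∈F z∈X)
        (WeakSplit.common∈Z weak (symm G (fX x∈X)) (symm G (fX y∈X)))
        (WeakSplit.common∈Z weak (symm G (f′X x∈X)) (symm G (f′X y∈X))) z∈Z
      ... | inj₂ (inj₂ z∈B) = no-weak-pair y∈X x∈X X⊆′ (swapWeak weak) z∈B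

      module Strong (near-z : Adj G x z ⊎ Adj G y z) (strong : StrongSplit x y) where
        open Split xy strong

        end-F : ∀ {g} → g ∈ F → (∀ {v} → v ∈ X → Adj G g v) → c g ≡ nothing
        end-F g∈F gX = common-off (symm G (gX x∈X)) (symm G (gX y∈X))

        off-rest : ∀ {w d} → d ∈ˡ rest → c w ≡ just d → w ∉ X
        off-rest d∈ cw w∈X with X⊆ w∈X
        ... | here refl = end-label cw (inj₁ refl) d∈
        ... | there (here refl) = end-label cw (inj₂ refl) d∈
        ... | there (there (here refl)) =
          [ (λ xz → ≢-rest lu∉rest d∈ (respects-rest d∈ xz cu cw))
          , (λ yz → ≢-rest lv∉rest d∈ (respects-rest d∈ yz cv cw)) ]′ near-z

        -- No vertex of `X` has a label in `rest`: two are the ends, and `z` is adjacent to one of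
        -- them. Both `f` and `f′` thus fall into `I`, against `∣I∣≤1`.
        ∈I : ∀ {g} → g ∈ F → (∀ {v} → v ∈ X → Adj G g v) →
          (∀ {w} → Adj G g w → w ∈ X ⊎ c w ≡ nothing) → g ∈ I
        ∈I g∈F gX near with T-or-I (symm G (gX x∈X)) (symm G (gX y∈X))
        ... | inj₂ g∈I = g∈I
        ... | inj₁ g∈T = ⊥-elim (case (T-third g∈T))
          where
          case : ¬ (∃₂ λ d w → d ∈ˡ rest × c w ≡ just d × Adj G w _)
          case (d , w , d∈ , cw , wg) with near (symm G wg)
          ... | inj₁ w∈X = off-rest d∈ cw w∈X
          ... | inj₂ cw′ = contradiction (trans (sym cw) cw′) λ ()

        f-near : ∀ {w} → Adj G f w → w ∈ X ⊎ c w ≡ nothing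
        f-near fw with near-F f∈F fw
        ... | inj₂ w∈X = inj₁ w∈X
        ... | inj₁ w∈F with F⊆ w∈F
        ... | here refl = inj₂ (end-F f∈F fX)
        ... | there (here refl) = inj₂ (end-F f′∈F f′X)

        f′-near : ∀ {w} → Adj G f′ w → w ∈ X ⊎ c w ≡ nothing
        f′-near f′w with near-F f′∈F f′w
        ... | inj₂ w∈X = inj₁ w∈X
        ... | inj₁ w∈F with F⊆ w∈F
        ... | here refl = inj₂ (end-F f∈F fX)
        ... | there (here refl) = inj₂ (end-F f′∈F f′X)

        absurd : ⊥
        absurd = f≢f′ (Merge.only-I (∈I f′∈F f′X f′-near) (∈I f∈F fX f-near))

      not-near : ¬ (Adj G x z ⊎ Adj G y z)
      not-near near-z = [ not-weak , Strong.absurd near-z ]′ (critical-split (critical xy))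

    -- Each of the three vertices of `X` has a neighbour in `X`, so some edge inside `X` has an end
    -- adjacent to the third vertex.
    no-pair : ⊥
    no-pair =
      let x , x∈X , _ = avoid X [] (≤-trans (s≤s z≤n) 3≤∣X∣)
          y , y∈X , xy = X-neighbour x∈X
          x≢y = λ x≡y → irrefl G x≡y xy
          z , z∈X , z∉ = avoid X (x ∷ y ∷ []) 3≤∣X∣
          x≢z = λ x≡z → z∉ (here (sym x≡z))
          y≢z = λ y≡z → z∉ (there (here (sym y≡z)))
          X⊆ = full X ((x≢y ∷ x≢z ∷ []) ∷ (y≢z ∷ []) ∷ [] ∷ []) (x∈X ∷ y∈X ∷ z∈X ∷ []) ∂F≤3
          w , w∈X , zw = X-neighbour z∈X
      in Edge.not-near x∈X y∈X z∈X X⊆ xy (near X⊆ w∈X zw)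
      where
      near : ∀ {x y z w} → (∀ {v} → v ∈ X → v ∈ˡ x ∷ y ∷ z ∷ []) → w ∈ X → Adj G z w →
        Adj G x z ⊎ Adj G y z
      near X⊆ w∈X zw with X⊆ w∈X
      ... | here refl = inj₁ (symm G zw)
      ... | there (here refl) = inj₂ (symm G zw)
      ... | there (there (here refl)) = contradiction zw (irrefl G refl)

  3≤∣F∣ : 3 ≤ card F
  3≤∣F∣ = ≮⇒≥ λ lt →
    let f , f∈F , f≢p₀ = another p₀
    in Pair.no-pair f∈F p₀∈F f≢p₀ (full F ((f≢p₀ ∷ []) ∷ [] ∷ []) (f∈F ∷ p₀∈F ∷ []) (s≤s⁻¹ lt))

  -- Edges between the boundary and the fragment

  record Local (x f : Fin n) : Set where
    field
      {r}        : Fin n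
      r∈F̄        : r ∈ F̄
      xr         : Adj G x r
      common     : ∀ {p} → Adj G x p → p ≢ f → p ≢ r → Adj G f p
      degree-f≤4 : card (N f) ≤ 4
      degree-x≤5 : card (N x) ≤ 5

  module StrongBoundary {x f} (x∈X : x ∈ X) (f∈F : f ∈ F) (xf : Adj G x f) (strong : StrongSplit x f) where
    open Split xf strong

    end-exterior : ∀ {e l d} → d ∈ˡ rest → c e ≡ just l → e ≡ x ⊎ e ≡ f → e ∈ exterior G (class c d)
    end-exterior d∈ ce e≡ = (λ p → end-label p e≡ d∈) ,
      λ e∈∂ → contradiction (trans (sym ce) (proj₁ (∂⊆touch d∈ _ e∈∂))) λ ()

    -- `pinned` applied to the third class: the ends `x` and `f` are exterior to it, and `s`, being
    -- adjacent to `f`, is not in `F̄`.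
    exact-third : ∀ {f′ s d w} → f′ ∈ F → f′ ≢ f → c f′ ≡ nothing → s ∈ T → d ∈ˡ rest →
      c w ≡ just d → Adj G w s → card (∂ G (class c d)) ≤ 3 → s ∉ F × ∃ λ o → o ∈ F̄ × c o ≡ just d
    exact-third {w = w} f′∈F f′≢f cf′ s∈T d∈ cw ws ≤3 = pinned (class c _) ≤3 cw
      x∈X (end-exterior d∈ cu (inj₁ refl)) f∈F (end-exterior d∈ cv (inj₂ refl)) f′∈F f′≢f
      (λ p → contradiction (trans (sym cf′) p) λ ())
      ((λ p → contradiction (trans (sym (T-off s∈T)) p) λ ()) , w , cw , ws)
      (λ s∈F̄ → F≁F̄ f∈F s∈F̄ (T-adj-v s∈T))

    module _ {f′} (f′∈F : f′ ∈ F) (xf′ : Adj G x f′) (f′≢f : f′ ≢ f) (f′∈I : f′ ∈ I) where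

      I-off : c f′ ≡ nothing
      I-off = proj₁ (proj₁ (proj₁ f′∈I))

      tight-third : ∀ {s} → s ∈ T → s ∉ F × ∃₂ λ d o → d ∈ˡ rest × o ∈ F̄ × c o ≡ just d
      tight-third s∈T =
        let d , w , d∈ , cw , ws = T-third s∈T
            s∉F , o , o∈F̄ , co = exact-third f′∈F f′≢f I-off s∈T d∈ cw ws (Merge.∂rest≤3 f′∈I d∈)
        in s∉F , d , o , d∈ , o∈F̄ , co

      F⊆E : ∀ {d o} → d ∈ˡ rest → o ∈ F̄ → c o ≡ just d → ∀ {g} → g ∈ F → g ∈ E
      F⊆E d∈ o∈F̄ co = uncross E f∈F (inj₁ (inj₂ cv)) (Merge.∂E≤3 f′∈I) o∈F̄
        (Merge.rest∉E d∈ co , λ (_ , _ , e∈E , eo) → Merge.E-closed e∈E d∈ co eo)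

      T⊆X : ∀ {s} → s ∈ T → s ∈ X
      T⊆X s∈T with near-F f∈F (T-adj-v s∈T)
      ... | inj₁ s∈F = contradiction s∈F (proj₁ (tight-third s∈T))
      ... | inj₂ s∈X = s∈X

      F-pair : DSet n
      F-pair = F ∖ fromList (f ∷ f′ ∷ [])

      -- A third neighbour of `x` in `F` would be adjacent to `f`, hence in `T`, which avoids `F`,
      -- or in `I`, which is only `f′`. Since `F` lies in `E`, the vertex `s` of `T` sees nothing in
      -- `F` but `f` and `f′`. Removing these two leaves a smaller fragment.
      boundary : ∀ {s z} → s ∈ T → (∀ {g} → g ∈ F → g ∈ E) →
        (∀ {v} → v ∈ X → v ∈ˡ x ∷ s ∷ z ∷ []) → ∀ v → v ∈ ∂ G F-pair → v ∈ˡ f ∷ f′ ∷ z ∷ []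
      boundary {s} {z} s∈T F⊆E X⊆ v (v∉ , u , (u∈F , u∉) , uv) with v ∈? (f ∷ f′ ∷ [])
      ... | yes (here eq) = here eq
      ... | yes (there (here eq)) = there (here eq)
      ... | no v∉pair with near-F u∈F uv
      ... | inj₁ v∈F = contradiction (v∈F , v∉pair) v∉
      ... | inj₂ v∈X with X⊆ v∈X
      ... | there (there (here eq)) = there (there (here eq))
      ... | here refl with T-or-I (symm G uv) (clique x∈X f∈F u∈F xf (symm G uv) λ { refl → u∉ (here refl) })
      ... | inj₁ u∈T = contradiction u∈F (proj₁ (tight-third u∈T))
      ... | inj₂ u∈I = contradiction (there (here (Merge.only-I f′∈I u∈I))) u∉
      boundary {s} {z} s∈T F⊆E X⊆ v (v∉ , u , (u∈F , u∉) , uv) | no _ | inj₂ v∈X | there (here refl) with F⊆E u∈F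
      ... | inj₁ (inj₁ cu′) = contradiction (T-touch-u s∈T cu′ uv) (F≢X u∈F x∈X)
      ... | inj₁ (inj₂ cv′) = contradiction (here (T-touch-v s∈T cv′ uv)) u∉
      ... | inj₂ u∈I = contradiction (there (here (Merge.only-I f′∈I u∈I))) u∉

      I-absurd : ⊥
      I-absurd =
        let s , s∈T = T-nonempty
            _ , d , o , d∈ , o∈F̄ , co = tight-third s∈T
            s∈X = T⊆X s∈T
            x≢s = λ x≡s → irrefl G x≡s (T-adj-u s∈T)
            z , z∈X , z∉ = avoid X (x ∷ s ∷ []) 3≤∣X∣
            X⊆ = full X ((x≢s ∷ (λ x≡z → z∉ (here (sym x≡z))) ∷ []) ∷
              ((λ s≡z → z∉ (there (here (sym s≡z)))) ∷ []) ∷ [] ∷ [])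
              (x∈X ∷ s∈X ∷ z∈X ∷ []) ∂F≤3
            p , p∈F , p∉ = avoid F (f ∷ f′ ∷ []) 3≤∣F∣
        in proj₂ (shrink F-pair (f ∷ f′ ∷ z ∷ []) (λ _ → proj₁) (p∈F , p∉)
             (boundary s∈T (F⊆E d∈ o∈F̄ co) X⊆) ≤-refl f∈F) (here refl)

    module _ {f′} (f′∈F : f′ ∈ F) (f′≢f : f′ ≢ f) (f′∈T : f′ ∈ T) where

      -- With three boundary vertices the third class would force `f′` out of `F` by `exact-third`;
      -- a fourth one is an extra incidence that tightens the count.
      few : card (touch c lu) + card (touch c lv) ≤ 4 + card T
      few = let d , w , d∈ , cw , wf′ = T-third f′∈T in
        touches-≤′ d∈ (≮⇒≥ λ lt → proj₁ (exact-third f′∈F f′≢f (T-off f′∈T) f′∈T d∈ cw wf′ (s≤s⁻¹ lt)) f′∈F)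

      near-x : ∀ {p} → Adj G x p → p ≢ f → p ∈ touch c lu
      near-x xp p≢f with near-u xp
      ... | inj₁ p≡f = contradiction p≡f p≢f
      ... | inj₂ (inj₁ cp) = contradiction xp (irrefl G (sym (lone-u few cp)))
      ... | inj₂ (inj₂ p∈) = p∈

      near-f : ∀ {p} → Adj G f p → p ≢ x → p ∈ touch c lv
      near-f fp p≢x with near-v fp
      ... | inj₁ p≡x = contradiction p≡x p≢x
      ... | inj₂ (inj₁ cp) = contradiction fp (irrefl G (sym (lone-v few cp)))
      ... | inj₂ (inj₂ p∈) = p∈

      T⊆u : ∀ {s} → s ∈ˡ elements T → s ∈ touch c lu
      T⊆u s∈ = proj₁ (proj₁ (∈-elements⁻ T s∈))

      ∣u∣≤1+∣T∣ : card (touch c lu) ≤ 1 + card T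
      ∣u∣≤1+∣T∣ = +-cancelʳ-≤ 3 _ _ (≤-trans (+-monoʳ-≤ (card (touch c lu)) 3≤touch-v)
        (≤-trans few (≤-reflexive (+-comm 3 (1 + card T)))))

      module _ {r} (r∈F̄ : r ∈ F̄) (xr : Adj G x r) where

        r∈u : r ∈ touch c lu
        r∈u = near-x xr (F≢F̄ f∈F r∈F̄ ∘ sym)

        r∉T : ∀ {s} → s ∈ˡ elements T → r ≢ s
        r∉T s∈ refl = F≁F̄ f∈F r∈F̄ (T-adj-v (∈-elements⁻ T s∈))

        -- `r` is not adjacent to `f` and so not in `T`. Together with `few` this makes `touch c lu`
        -- exactly `T` and `r`, and leaves three vertices for `touch c lv`.
        1+∣T∣≤∣u∣ : 1 + card T ≤ card (touch c lu)
        1+∣T∣≤∣u∣ = card-≥ (touch c lu) (All.tabulate r∉T ∷ elements! T) (r∈u ∷ All.tabulate T⊆u)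

        ∣v∣≤3 : card (touch c lv) ≤ 3
        ∣v∣≤3 = +-cancelˡ-≤ (1 + card T) _ _ (≤-trans (+-monoˡ-≤ (card (touch c lv)) 1+∣T∣≤∣u∣)
          (≤-trans few (≤-reflexive (+-comm 3 (1 + card T)))))

        common-x : ∀ {p} → Adj G x p → p ≢ f → p ≢ r → Adj G f p
        common-x {p} xp p≢f p≢r with member? T p
        ... | yes p∈T = T-adj-v p∈T
        ... | no p∉T = contradiction (card-≥ (touch c lu)
          ((p≢r ∷ All.tabulate λ { s∈ refl → p∉T (∈-elements⁻ T s∈) }) ∷ All.tabulate r∉T ∷ elements! T)
          (near-x xp p≢f ∷ r∈u ∷ All.tabulate T⊆u)) (<⇒≱ (s≤s ∣u∣≤1+∣T∣))

        N-f⊆ : ∀ v → v ∈ N f → v ∈ˡ x ∷ elements (touch c lv)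
        N-f⊆ v fv with v ≟ x
        ... | yes v≡x = here v≡x
        ... | no v≢x = there (∈-elements⁺ (touch c lv) (near-f fv v≢x))

        N-x⊆ : ∀ v → v ∈ N x → v ∈ˡ f ∷ elements (touch c lu)
        N-x⊆ v xv with v ≟ f
        ... | yes v≡f = here v≡f
        ... | no v≢f = there (∈-elements⁺ (touch c lu) (near-x xv v≢f))

        T-local : Local x f
        T-local = record
          { r∈F̄ = r∈F̄ ; xr = xr ; common = common-x
          ; degree-f≤4 = ≤-trans (card-≤ (N f) (x ∷ elements (touch c lv)) N-f⊆) (s≤s ∣v∣≤3)
          -- One for `f`, one for `r`, and at most three for `T`, which lies in `touch c lv`.
          ; degree-x≤5 = ≤-trans (card-≤ (N x) (f ∷ elements (touch c lu)) N-x⊆)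
              (s≤s (≤-trans ∣u∣≤1+∣T∣ (s≤s (≤-trans (card-mono T (touch c lv) (λ _ s∈T → proj₂ (proj₁ s∈T))) ∣v∣≤3)))) }

    strong-local : Local x f
    strong-local =
      let f′ , f′∈F , xf′ , f′≢f = neighbour-F x∈X f∈F
          r , r∈F̄ , xr = neighbour-F̄ x∈X
      in [ (λ f′∈T → T-local f′∈F f′≢f f′∈T r∈F̄ xr)
         , (λ f′∈I → ⊥-elim (I-absurd f′∈F xf′ f′≢f f′∈I)) ]′
         (T-or-I xf′ (clique x∈X f∈F f′∈F xf xf′ (f′≢f ∘ sym)))

  abstract
    local : ∀ {x f} → x ∈ X → f ∈ F → Adj G x f → Local x f
    local x∈X f∈F xf = [ (λ weak → ⊥-elim (no-weak-boundary x∈X f∈F xf weak))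
      , StrongBoundary.strong-local x∈X f∈F xf ]′ (critical-split (critical xf))

    -- Otherwise every neighbour of `x` in `F` has all its other neighbours adjacent to `x`. By
    -- 3-connectedness `x` is then adjacent to all of `F`, and through `F` to the rest of `X`, which
    -- exceeds the degree bound of `Local`.
    degree-X≤4 : ∀ {x} → x ∈ X → card (N x) ≤ 4
    degree-X≤4 {x} x∈X = ≮⇒≥ λ 5≤degree → absurd 5≤degree
      where
      module _ (5≤degree : 5 ≤ card (N x)) where

        module _ {f} (xf : Adj G x f) (l : Local x f) where
          open Local l

          K : DSet n
          K = N x ∖ fromList (f ∷ r ∷ [])

          K⊆N-f : ∀ {p} → p ∈ K → Adj G f p
          K⊆N-f (xp , p∉) = common xp (λ eq → p∉ (here eq)) (λ eq → p∉ (there (here eq)))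

          N-x⊆ : ∀ v → v ∈ N x → v ∈ˡ f ∷ r ∷ elements K
          N-x⊆ v xv with v ∈? (f ∷ r ∷ [])
          ... | yes (here eq) = here eq
          ... | yes (there (here eq)) = there (here eq)
          ... | no v∉ = there (there (∈-elements⁺ K (xv , v∉)))

          3≤∣K∣ : 3 ≤ card K
          3≤∣K∣ = s≤s⁻¹ (s≤s⁻¹ (≤-trans 5≤degree (card-≤ (N x) (f ∷ r ∷ elements K) N-x⊆)))

          -- `x` and the at least three vertices of `K` already use up the degree of `f`.
          closed : ∀ {q} → Adj G f q → q ≡ x ⊎ Adj G x q
          closed {q} fq = case (full (N f) {x ∷ elements K}
            (All.tabulate (λ { p∈ refl → irrefl G refl (proj₁ (∈-elements⁻ K p∈)) }) ∷ elements! K)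
            (symm G xf ∷ All.tabulate λ p∈ → K⊆N-f (∈-elements⁻ K p∈))
            (≤-trans degree-f≤4 (s≤s 3≤∣K∣)) fq)
            where
            case : q ∈ˡ x ∷ elements K → q ≡ x ⊎ Adj G x q
            case (here q≡x) = inj₁ q≡x
            case (there q∈K) = inj₂ (proj₁ (∈-elements⁻ K q∈K))

        boundary : ∀ {y z} → (∀ {v} → v ∈ X → v ∈ˡ x ∷ y ∷ z ∷ []) → ∀ v → v ∈ ∂ G (F ∖ N x) → v ∈ˡ y ∷ z ∷ []
        boundary X⊆ v (v∉ , u , (u∈F , ¬xu) , uv) with near-F u∈F uv
        ... | inj₂ v∈X with X⊆ v∈X
        ... | here refl = contradiction (symm G uv) ¬xu
        ... | there v∈ = v∈
        boundary X⊆ v (v∉ , u , (u∈F , ¬xu) , uv) | inj₁ v∈F with adj? G x v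
        ... | no ¬xv = contradiction (v∈F , ¬xv) v∉
        ... | yes xv with closed xv (local x∈X v∈F xv) (symm G uv)
        ... | inj₁ u≡x = contradiction u≡x (F≢X u∈F x∈X)
        ... | inj₂ xu = contradiction xu ¬xu

        F⊆N : ∀ {g} → g ∈ F → Adj G x g
        F⊆N {g} g∈F with adj? G x g
        ... | yes xg = xg
        ... | no ¬xg = let y , z , (y∈X , z∈X) , _ , X⊆ = corners x∈X in
          contradiction (3-connected (F ∖ N x) (y ∷ z ∷ []) (g∈F , ¬xg) (proj₁ o₀∈F̄ ∘ proj₁)
            (λ { (here eq) → X≢F̄ y∈X o₀∈F̄ (sym eq) ; (there (here eq)) → X≢F̄ z∈X o₀∈F̄ (sym eq) })
            (boundary X⊆)) λ { (s≤s (s≤s ())) }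

        X⊆N : ∀ {y} → y ∈ X → x ≢ y → Adj G x y
        X⊆N y∈X x≢y = let g , g∈F , yg , _ = neighbour-F y∈X p₀∈F in
          [ (λ y≡x → contradiction (sym y≡x) x≢y) , id ]′ (closed (F⊆N g∈F) (local x∈X g∈F (F⊆N g∈F)) (symm G yg))

        6≤degree : ∀ {y z r} → y ∈ X → z ∈ X → r ∈ F̄ → Adj G x r → x ≢ y → x ≢ z → y ≢ z → 6 ≤ card (N x)
        6≤degree {y} {z} {r} y∈X z∈X r∈F̄ xr x≢y x≢z y≢z = ≤-trans (s≤s (s≤s (s≤s 3≤∣F∣)))
          (card-≥ (N x) {y ∷ z ∷ r ∷ elements F}
            ((y≢z ∷ X≢F̄ y∈X r∈F̄ ∷ All.tabulate (λ g∈ → F≢X (∈-elements⁻ F g∈) y∈X ∘ sym)) ∷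
             (X≢F̄ z∈X r∈F̄ ∷ All.tabulate (λ g∈ → F≢X (∈-elements⁻ F g∈) z∈X ∘ sym)) ∷
             All.tabulate (λ g∈ → F≢F̄ (∈-elements⁻ F g∈) r∈F̄ ∘ sym) ∷ elements! F)
            (X⊆N y∈X x≢y ∷ X⊆N z∈X x≢z ∷ xr ∷ All.tabulate (λ g∈ → F⊆N (∈-elements⁻ F g∈))))

        absurd : ⊥
        absurd =
          let y , z , (y∈X , z∈X) , (x≢y , x≢z , y≢z) , _ = corners x∈X
              f , f∈F , xf , _ = neighbour-F x∈X p₀∈F
              r , r∈F̄ , xr = neighbour-F̄ x∈X
          in <⇒≱ (6≤degree y∈X z∈X r∈F̄ xr x≢y x≢z y≢z) (Local.degree-x≤5 (local x∈X f∈F xf))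

    common-neighbour : ∀ {x g p} → x ∈ X → g ∈ F → Adj G x g → Adj G x p → p ∉ F̄ → p ≢ g → Adj G g p
    common-neighbour x∈X g∈F xg xp p∉F̄ p≢g =
      common xp p≢g (λ p≡r → p∉F̄ (subst (_∈ F̄) (sym p≡r) r∈F̄))
      where open Local (local x∈X g∈F xg)

  -- The edge leaving the clique

  module Star {x f f′ r h q} (x∈X : x ∈ X) (f∈F : f ∈ F) (f′∈F : f′ ∈ F) (r∈F̄ : r ∈ F̄)
    (xf : Adj G x f) (xf′ : Adj G x f′) (xr : Adj G x r) (xh : Adj G x h) (fh : Adj G f h) (fq : Adj G f q)
    (f≢f′ : f ≢ f′) (h≢f′ : h ≢ f′) (q≢x : q ≢ x) (q≢f′ : q ≢ f′) (q≢h : q ≢ h) where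

    h∉F̄ : h ∉ F̄
    h∉F̄ h∈F̄ = F≁F̄ f∈F h∈F̄ fh

    x≢ : ∀ {v} → Adj G x v → x ≢ v
    x≢ xv x≡v = irrefl G x≡v xv

    f≢ : ∀ {v} → Adj G f v → f ≢ v
    f≢ fv f≡v = irrefl G f≡v fv

    ff′ : Adj G f f′
    ff′ = clique x∈X f∈F f′∈F xf xf′ f≢f′

    f′h : Adj G f′ h
    f′h = common-neighbour x∈X f′∈F xf′ xh h∉F̄ h≢f′

    h≢r : h ≢ r
    h≢r refl = h∉F̄ r∈F̄

    abstract
      N-x : ∀ {v} → Adj G x v → v ∈ˡ f ∷ f′ ∷ r ∷ h ∷ []
      N-x = full (N x) ((f≢f′ ∷ F≢F̄ f∈F r∈F̄ ∷ f≢ fh ∷ []) ∷ (F≢F̄ f′∈F r∈F̄ ∷ (h≢f′ ∘ sym) ∷ []) ∷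
        ((h≢r ∘ sym) ∷ []) ∷ [] ∷ []) (xf ∷ xf′ ∷ xr ∷ xh ∷ []) (degree-X≤4 x∈X)

      N-f : ∀ {v} → Adj G f v → v ∈ˡ x ∷ f′ ∷ h ∷ q ∷ []
      N-f = full (N f) ((x≢ xf′ ∷ x≢ xh ∷ (q≢x ∘ sym) ∷ []) ∷ ((h≢f′ ∘ sym) ∷ (q≢f′ ∘ sym) ∷ []) ∷
        ((q≢h ∘ sym) ∷ []) ∷ [] ∷ []) (symm G xf ∷ ff′ ∷ fh ∷ fq ∷ []) (Local.degree-f≤4 (local x∈X f∈F xf))

    x≁q : ¬ Adj G x q
    x≁q xq with N-x xq
    ... | here refl = irrefl G refl fq
    ... | there (here q≡f′) = q≢f′ q≡f′
    ... | there (there (here refl)) = F≁F̄ f∈F r∈F̄ fq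
    ... | there (there (there (here q≡h))) = q≢h q≡h

    abstract
      N-fourth : ∀ {s o} → s ∈ F → Adj G x s → Adj G f s → Adj G x o → Adj G f o → o ≢ s → Adj G s q →
        ∀ {v} → Adj G s v → v ∈ˡ x ∷ f ∷ o ∷ q ∷ []
      N-fourth {s} {o} s∈F xs fs xo fo o≢s sq = full (N s)
        ((x≢ xf ∷ x≢ xo ∷ (q≢x ∘ sym) ∷ []) ∷ (f≢ fo ∷ f≢ fq ∷ []) ∷
         ((λ { refl → x≁q xo }) ∷ []) ∷ [] ∷ [])
        (symm G xs ∷ symm G fs ∷
         common-neighbour x∈X s∈F xs xo (λ o∈F̄ → F≁F̄ f∈F o∈F̄ fo) o≢s ∷ sq ∷ [])
        (Local.degree-f≤4 (local x∈X s∈F xs))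

    module Strong (q∈F : q ∈ F) (strong : StrongSplit f q) where
      open Split fq strong

      no-third : ∀ {o d w} → Adj G f o → d ∈ˡ rest → c w ≡ just d → w ∉ˡ x ∷ f ∷ o ∷ q ∷ []
      no-third fo d∈ cw (here refl) = ≢-rest lu∉rest d∈ (respects-rest d∈ (symm G xf) cu cw)
      no-third fo d∈ cw (there (here w≡f)) = end-label cw (inj₁ w≡f) d∈
      no-third fo d∈ cw (there (there (here refl))) = ≢-rest lu∉rest d∈ (respects-rest d∈ fo cu cw)
      no-third fo d∈ cw (there (there (there (here w≡q)))) = end-label cw (inj₂ w≡q) d∈

      -- If `s` were in `T`, its four neighbours would be `x`, `f`, `o` and `q`: the ends of the
      -- edge and two neighbours of `f`, none with a label in `rest`.
      ∉T : ∀ {s o} → s ∈ F → Adj G x s → Adj G x o → Adj G f o → o ≢ s → s ∉ T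
      ∉T s∈F xs xo fo o≢s s∈T = let d , w , d∈ , cw , ws = T-third s∈T in
        no-third fo d∈ cw (N-fourth s∈F xs (T-adj-u s∈T) xo fo o≢s (symm G (T-adj-v s∈T)) (symm G ws))

      h∉T : h ∉ T
      h∉T h∈T with near-F f∈F fh
      ... | inj₁ h∈F = ∉T h∈F xh xf′ ff′ (h≢f′ ∘ sym) h∈T
      ... | inj₂ h∈X = h≁q h∈X (symm G (T-adj-v h∈T))
        where
        -- In `X` the degree of `h` is at most four, and `x`, `f`, `f′` and an exterior neighbour
        -- use it up.
        h≁q : h ∈ X → ¬ Adj G h q
        h≁q h∈X hq = let r′ , r′∈F̄ , hr′ = neighbour-F̄ h∈X in
          case r′∈F̄ (full (N h) ((x≢ xf ∷ x≢ xf′ ∷ X≢F̄ x∈X r′∈F̄ ∷ []) ∷ (f≢f′ ∷ F≢F̄ f∈F r′∈F̄ ∷ []) ∷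
              (F≢F̄ f′∈F r′∈F̄ ∷ []) ∷ [] ∷ [])
            (symm G xh ∷ symm G fh ∷ symm G f′h ∷ hr′ ∷ []) (degree-X≤4 h∈X) hq)
          where
          case : ∀ {r′} → r′ ∈ F̄ → q ∉ˡ x ∷ f ∷ f′ ∷ r′ ∷ []
          case r′∈F̄ (here q≡x) = q≢x q≡x
          case r′∈F̄ (there (here refl)) = irrefl G refl fq
          case r′∈F̄ (there (there (here q≡f′))) = q≢f′ q≡f′
          case r′∈F̄ (there (there (there (here q≡r′)))) = F≢F̄ q∈F r′∈F̄ q≡r′

      T-empty : ∀ {s} → s ∉ T
      T-empty s∈T with N-f (T-adj-u s∈T)
      ... | here refl = x≁q (symm G (T-adj-v s∈T))
      ... | there (here refl) = ∉T f′∈F xf′ xh fh h≢f′ s∈T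
      ... | there (there (here refl)) = h∉T s∈T
      ... | there (there (there (here refl))) = irrefl G refl (T-adj-v s∈T)

      absurd : ⊥
      absurd = T-empty (proj₂ T-nonempty)

    q∉F : q ∉ F
    q∉F q∈F = [ no-weak-inside 3≤∣F∣ f∈F q∈F , Strong.absurd q∈F ]′ (critical-split (critical fq))

    module Corner (q∈X : q ∈ X) where

      -- By `Local`, neighbours of `q` other than `f` and `r′` are among those of `f`, and `x` is
      -- not one. Degree four leaves no choice but all the remaining candidates.
      N-q : ∀ {v} → v ∈ˡ f ∷ Local.r (local q∈X f∈F (symm G fq)) ∷ f′ ∷ h ∷ [] → Adj G q v
      N-q = saturate (N q) (f ∷ r′ ∷ f′ ∷ h ∷ []) sub (4≤degree q)
        where
        open Local (local q∈X f∈F (symm G fq)) renaming (r to r′; common to common′)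
        sub : ∀ v → Adj G q v → v ∈ˡ f ∷ r′ ∷ f′ ∷ h ∷ []
        sub v qv with v ≟ f | v ≟ r′
        ... | yes eq | _ = here eq
        ... | no _ | yes eq = there (here eq)
        ... | no v≢f | no v≢r′ with N-f (common′ qv v≢f v≢r′)
        ... | here refl = contradiction (symm G qv) x≁q
        ... | there (here eq) = there (there (here eq))
        ... | there (there (here eq)) = there (there (there (here eq)))
        ... | there (there (there (here refl))) = contradiction qv (irrefl G refl)

      qf′ : Adj G q f′
      qf′ = N-q (there (there (here refl)))

      qh : Adj G q h
      qh = N-q (there (there (there (here refl))))

      h∉X : h ∉ X
      h∉X h∈X = let r′ , r′∈F̄ , hr′ = neighbour-F̄ h∈X in
        <⇒≱ (card-≥ (N h) ((x≢ xf ∷ x≢ xf′ ∷ (q≢x ∘ sym) ∷ X≢F̄ x∈X r′∈F̄ ∷ []) ∷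
            (f≢f′ ∷ f≢ fq ∷ F≢F̄ f∈F r′∈F̄ ∷ []) ∷ ((q≢f′ ∘ sym) ∷ F≢F̄ f′∈F r′∈F̄ ∷ []) ∷
            (X≢F̄ q∈X r′∈F̄ ∷ []) ∷ [] ∷ [])
          (symm G xh ∷ symm G fh ∷ symm G f′h ∷ symm G qh ∷ hr′ ∷ [])) (degree-X≤4 h∈X)

      -- All of `f`, `f′` and `h` have degree four, and `x` and `q` would separate the three from
      -- the graph.
      h∉F : h ∉ F
      h∉F h∈F = contradiction (3-connected (fromList (f ∷ f′ ∷ h ∷ [])) (x ∷ q ∷ []) {o = o₀} (here refl)
        (λ { (here refl) → F≢F̄ f∈F o₀∈F̄ refl
           ; (there (here refl)) → F≢F̄ f′∈F o₀∈F̄ refl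
           ; (there (there (here refl))) → F≢F̄ h∈F o₀∈F̄ refl })
        (λ { (here refl) → X≢F̄ x∈X o₀∈F̄ refl ; (there (here refl)) → X≢F̄ q∈X o₀∈F̄ refl })
        boundary) λ { (s≤s (s≤s ())) }
        where
        boundary : ∀ v → v ∈ ∂ G (fromList (f ∷ f′ ∷ h ∷ [])) → v ∈ˡ x ∷ q ∷ []
        boundary v (v∉ , u , here refl , fv) with N-f fv
        ... | here eq = here eq
        ... | there (here eq) = contradiction (there (here eq)) v∉
        ... | there (there (here eq)) = contradiction (there (there (here eq))) v∉
        ... | there (there (there (here eq))) = there (here eq)
        boundary v (v∉ , u , there (here refl) , f′v)
          with N-fourth f′∈F xf′ ff′ xh fh h≢f′ (symm G qf′) f′v
        ... | here eq = here eq
        ... | there (here eq) = contradiction (here eq) v∉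
        ... | there (there (here eq)) = contradiction (there (there (here eq))) v∉
        ... | there (there (there (here eq))) = there (here eq)
        boundary v (v∉ , u , there (there (here refl)) , hv)
          with N-fourth h∈F xh fh xf′ ff′ (h≢f′ ∘ sym) (symm G qh) hv
        ... | here eq = here eq
        ... | there (here eq) = contradiction (here eq) v∉
        ... | there (there (here eq)) = contradiction (there (here eq)) v∉
        ... | there (there (there (here eq))) = there (here eq)

    absurd : ⊥
    absurd = [ q∉F , (λ q∈X → [ Corner.h∉F q∈X , Corner.h∉X q∈X ]′ (near-F f∈F fh)) ]′ (near-F f∈F fq)

  absurd : ⊥
  absurd =
    let x , x∈X , _ = avoid X [] (≤-trans (s≤s z≤n) 3≤∣X∣)
        f , f∈F , xf , _ = neighbour-F x∈X p₀∈F
        f′ , f′∈F , xf′ , f′≢f = neighbour-F x∈X f∈F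
        open Local (local x∈X f∈F xf)
        h , xh , h∉ = avoid (N x) (f ∷ f′ ∷ r ∷ []) (4≤degree x)
        fh = common xh (λ eq → h∉ (here eq)) (λ eq → h∉ (there (there (here eq))))
        q , fq , q∉ = avoid (N f) (x ∷ f′ ∷ h ∷ []) (4≤degree f)
    in Star.absurd x∈X f∈F f′∈F r∈F̄ xf xf′ xr xh fh fq (f′≢f ∘ sym)
         (λ eq → h∉ (there (here eq))) (λ eq → q∉ (here eq)) (λ eq → q∉ (there (here eq)))
         (λ eq → q∉ (there (there (here eq))))

-- Recursion on the size supplies minimality: a smaller fragment has already been refuted.
no-fragment : ∀ {n} (G : Graph n) → Tough G → NoClaw G → (∀ v → 4 ≤ card (Boundary.N G v)) →
  (∀ {u v} → Adj G u v → Critical G u v) →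
  ∀ F {p o} → p ∈ F → o ∈ exterior G F → ¬ card (∂ G F) ≤ 3
no-fragment {n} G tough noClaw 4≤degree critical F p∈F o∈F̄ ∂F≤3 = go F (<-wellFounded _) p∈F o∈F̄ ∂F≤3
  where
  go : ∀ F {p o} → Acc _<_ (card F) → p ∈ F → o ∈ exterior G F → ¬ card (∂ G F) ≤ 3
  go F (acc smaller) p∈F o∈F̄ ∂F≤3 =
    MinimalFragment.absurd G tough noClaw 4≤degree critical F ∂F≤3 p∈F o∈F̄
      λ P p∈P o∈P̄ ∂P≤3 → ≮⇒≥ λ lt → go P (smaller lt) p∈P o∈P̄ ∂P≤3

-- Components and toughness

count-tabulate-≤ : ∀ {n} {A : Set} {P : Pred A 0ℓ} (P? : Decidable P) (f : Fin n → A) (S : Subset n) →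
  (∀ i → P (f i) → i Subset.∈ S) → count P? (tabulate f) ≤ ∣ S ∣
count-tabulate-≤ P? f [] sub = z≤n
count-tabulate-≤ P? f (s ∷ S) sub rewrite count-∷ P? (f zero) (tabulate (f ∘ suc)) =
  head s (P? (f zero)) (sub zero) (count-tabulate-≤ P? (f ∘ suc) S λ i p → drop (sub (suc i) p))
  where
  drop : ∀ {i} → suc i Subset.∈ s ∷ S → i Subset.∈ S
  drop (there i∈) = i∈
  head : ∀ {k} s {Q : Set} (d : Dec Q) → (Q → zero Subset.∈ s ∷ S) → k ≤ ∣ S ∣ → 𝟙 d + k ≤ ∣ s ∷ S ∣
  head inside  (yes _) _ le = s≤s le
  head inside  (no _)  _ le = m≤n⇒m≤1+n le
  head outside (yes q) f le with f q
  ... | ()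
  head outside (no _)  _ le = le

count-tabulate-≥ : ∀ {n} {A : Set} {P : Pred A 0ℓ} (P? : Decidable P) (f : Fin n → A) (S : Subset n) →
  (∀ i → i Subset.∈ S → P (f i)) → ∣ S ∣ ≤ count P? (tabulate f)
count-tabulate-≥ P? f [] sub = z≤n
count-tabulate-≥ P? f (s ∷ S) sub rewrite count-∷ P? (f zero) (tabulate (f ∘ suc)) =
  head s (P? (f zero)) (sub zero) (count-tabulate-≥ P? (f ∘ suc) S λ i i∈ → sub (suc i) (there i∈))
  where
  head : ∀ {k} s {Q : Set} (d : Dec Q) → (zero Subset.∈ s ∷ S → Q) → ∣ S ∣ ≤ k → ∣ s ∷ S ∣ ≤ 𝟙 d + k
  head inside  (yes _) _ le = s≤s le
  head inside  (no ¬q) f le = contradiction (f here) ¬q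
  head outside (yes _) _ le = m≤n⇒m≤1+n le
  head outside (no _)  _ le = le

lookup-injective : ∀ {A : Set} {R : A → A → Set} {xs} → Symmetric R → AllPairs (λ x y → ¬ R x y) xs →
  ∀ i j → R (lookup xs i) (lookup xs j) → i ≡ j
lookup-injective R-sym (_ ∷ _) zero zero r = refl
lookup-injective R-sym (x≁ ∷ _) zero (suc j) r = contradiction r (All.lookup x≁ (∈-lookup j))
lookup-injective R-sym (x≁ ∷ _) (suc i) zero r = contradiction (R-sym r) (All.lookup x≁ (∈-lookup i))
lookup-injective R-sym (_ ∷ xs!) (suc i) (suc j) r = cong suc (lookup-injective R-sym xs! i j r)

module Components {n} (G : Graph n) (S : Subset n) where

  Adj∖-sym : Symmetric (Adj∖ G S)
  Adj∖-sym (u∉ , v∉ , uv) = v∉ , u∉ , symm G uv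

  connected-sym : Symmetric (Connected∖ G S)
  connected-sym = reverse Adj∖-sym

  vertices representatives : List (Fin n)
  vertices = filter (λ v → ¬? (v ∈ˢ? S)) (allFin n)
  representatives = deduplicate (connected∖? G S) vertices

  representatives! : AllPairs (λ x y → ¬ Connected∖ G S x y) representatives
  representatives! = go vertices
    where
    go : ∀ xs → AllPairs (λ x y → ¬ Connected∖ G S x y) (deduplicate (connected∖? G S) xs)
    go []       = []
    go (x ∷ xs) = All.all-filter (λ y → ¬? (connected∖? G S x y)) (deduplicate (connected∖? G S) xs) ∷
      AllPairs.filter⁺ (λ y → ¬? (connected∖? G S x y)) (go xs)

  represented : ∀ {v} → v Subset.∉ S → Any (λ r → Connected∖ G S r v) representatives
  represented {v} v∉S = Any.deduplicate⁺ (connected∖? G S) (λ y~x x~v → y~x ◅◅ x~v)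
    (Any.map (λ { refl → ε }) (∈-filter⁺ (λ v → ¬? (v ∈ˢ? S)) (∈-allFin v) v∉S))

  representative∉S : ∀ {r} → r ∈ˡ representatives → r Subset.∉ S
  representative∉S r∈ = proj₂ (∈-filter⁻ (λ v → ¬? (v ∈ˢ? S)) {xs = allFin n}
    (∈-deduplicate⁻ (connected∖? G S) vertices r∈))

  representative : Fin (w G S) → Fin n
  representative = lookup representatives

  component : Labelling n (w G S)
  component v with v ∈ˢ? S
  ... | yes _   = nothing
  ... | no  v∉S = just (Any.index (represented v∉S))

  component-off : ∀ {v} → component v ≡ nothing → v Subset.∈ S
  component-off {v} eq with v ∈ˢ? S
  component-off {v} eq | yes v∈S = v∈S
  component-off {v} () | no _

  component-just : ∀ {v l} → component v ≡ just l → v Subset.∉ S × Connected∖ G S (representative l) v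
  component-just {v} eq with v ∈ˢ? S
  component-just {v} () | yes _
  component-just {v} refl | no v∉S = v∉S , Any.lookup-index (represented v∉S)

  component-total : ∀ {v} → v Subset.∉ S → ∃ λ l → component v ≡ just l
  component-total {v} v∉S with component v in eq
  ... | just l  = l , refl
  ... | nothing = contradiction (component-off eq) v∉S

  component-respects : Respects G component
  component-respects {x} {y} {l} {l′} xy cx cy with component-just cx | component-just cy
  ... | x∉S , lx | y∉S , ly = lookup-injective connected-sym representatives! l l′
    (lx ◅◅ ((x∉S , y∉S , xy) ◅ connected-sym ly))

  component-onto : ∀ l → ∃ λ v → component v ≡ just l
  component-onto l with component-total (representative∉S (∈-lookup l))
  ... | l′ , eq = representative l ,
    trans eq (cong just (lookup-injective connected-sym representatives! l′ l (proj₂ (component-just eq))))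

  card-off : card (off component) ≤ ∣ S ∣
  card-off = count-tabulate-≤ (member? (off component)) id S (λ _ → component-off)

  -- `c` is constant on each component, so every label of `ls` is already carried by a
  -- representative.
  labels≤components : ∀ {m} (c : Labelling n m) (ls : List (Fin m)) → Respects G c → Unique ls →
    (∀ v → c v ≡ nothing → v Subset.∈ S) → (∀ v → v Subset.∈ S → c v ≡ nothing) →
    (∀ {l} → l ∈ˡ ls → ∃ λ v → c v ≡ just l) → length ls ≤ w G S
  labels≤components c ls respects ls! off⊆S S⊆off attained =
    subst₂ _≤_ (length-map just ls) (length-map c representatives)
    (length-⊆ (Maybe.≡-dec _≟_) (Unique.map⁺ Maybe.just-injective ls!) sub)
    where
    label : ∀ {v} → v Subset.∉ S → ∃ λ l → c v ≡ just l
    label {v} v∉S with c v in eq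
    ... | just l  = l , refl
    ... | nothing = contradiction (off⊆S v eq) v∉S

    constant : ∀ {x y} → Connected∖ G S x y → c x ≡ c y
    constant ε = refl
    constant ((x∉S , z∉S , xz) ◅ path) with label x∉S | label z∉S
    ... | l , cx | l′ , cz = trans (trans cx (trans (cong just (respects xz cx cz)) (sym cz))) (constant path)

    sub : ∀ {k} → k ∈ˡ map just ls → k ∈ˡ map c representatives
    sub k∈ with ∈-map⁻ just k∈
    ... | l , l∈ , refl with attained l∈
    ... | v , cv with find (represented λ v∈S → contradiction (trans (sym cv) (S⊆off v v∈S)) λ ())
    ... | r , r∈ , path = subst (_∈ˡ map c representatives) (trans (constant path) cv) (∈-map⁺ c r∈)

-- Toughness as an attained minimum

∈-subsets : ∀ {n} (S : Subset n) → S ∈ˡ subsets n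
∈-subsets []            = here refl
∈-subsets (inside ∷ S)  = ∈-++⁺ˡ (∈-map⁺ (inside ∷_) (∈-subsets S))
∈-subsets (outside ∷ S) = ∈-++⁺ʳ (map (inside ∷_) (subsets _)) (∈-map⁺ (outside ∷_) (∈-subsets S))

∈-mapMaybe⁺ : ∀ {A B : Set} (f : A → Maybe B) {xs x y} → x ∈ˡ xs → f x ≡ just y → y ∈ˡ mapMaybe f xs
∈-mapMaybe⁺ f {x ∷ xs} (here refl) eq rewrite eq = here refl
∈-mapMaybe⁺ f {x ∷ xs} (there x∈) eq with f x
... | just _  = there (∈-mapMaybe⁺ f x∈ eq)
... | nothing = ∈-mapMaybe⁺ f x∈ eq

∈-mapMaybe⁻ : ∀ {A B : Set} (f : A → Maybe B) xs {y} → y ∈ˡ mapMaybe f xs → ∃ λ x → f x ≡ just y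
∈-mapMaybe⁻ f (x ∷ xs) y∈ with f x in eq
∈-mapMaybe⁻ f (x ∷ xs) (here refl) | just _ = x , eq
∈-mapMaybe⁻ f (x ∷ xs) (there y∈)  | just _ = ∈-mapMaybe⁻ f xs y∈
∈-mapMaybe⁻ f (x ∷ xs) y∈          | nothing = ∈-mapMaybe⁻ f xs y∈

module _ (a b c d : ℕ) where

  private
    p q : ℚᵘ.ℚᵘ
    p = ℚᵘ.mkℚᵘ (+ a) b
    q = ℚᵘ.mkℚᵘ (+ c) d

    cross : ∀ x y → + x ℤ.* + suc y ≡ + (x * suc y)
    cross x y = sym (ℤ.pos-* x (suc y))

  -- The fractions are normalised, so the comparison passes to unnormalised ones, where it is cross
  -- multiplication by definition.
  /-≤ : + a / suc b ℚ.≤ + c / suc d → a * suc d ≤ c * suc b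
  /-≤ le = ℤ.drop‿+≤+ (subst₂ ℤ._≤_ (cross a d) (cross c b) (ℚᵘ.drop-*≤*
    (ℚᵘ.≤-respˡ-≃ (ℚ.toℚᵘ-fromℚᵘ p) (ℚᵘ.≤-respʳ-≃ (ℚ.toℚᵘ-fromℚᵘ q) (ℚ.toℚᵘ-mono-≤ le)))))

  /-< : + a / suc b ℚ.< + c / suc d → a * suc d < c * suc b
  /-< lt = ℤ.drop‿+<+ (subst₂ ℤ._<_ (cross a d) (cross c b) (ℚᵘ.drop-*<*
    (ℚᵘ.<-respˡ-≃ (ℚ.toℚᵘ-fromℚᵘ p) (ℚᵘ.<-respʳ-≃ (ℚ.toℚᵘ-fromℚᵘ q) (ℚ.toℚᵘ-mono-< lt)))))

ratio⁻ : ∀ s c {q} → ratio s c ≡ just q → ∃ λ k → c ≡ suc (suc k) × q ≡ + s / suc (suc k)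
ratio⁻ s (suc (suc k)) refl = k , refl , refl

cut-ratio : ∀ {n} → Graph n → Subset n → Maybe ℚ
cut-ratio G S = ratio ∣ S ∣ (w G S)

toughness-attained : ∀ {n} (G : Graph n) → toughness G ≡ ⊤⁺ ⊎
  ∃ λ S → ∃ λ k → w G S ≡ suc (suc k) × toughness G ≡ [ + ∣ S ∣ / suc (suc k) ]
toughness-attained {n} G with Extrema.argmin-sel ℚ⁺-totalOrder id ⊤⁺ (map [_] (mapMaybe (cut-ratio G) (subsets n)))
... | inj₁ eq = inj₁ eq
... | inj₂ τ∈ with ∈-map⁻ [_] τ∈
... | q , q∈ , eq with ∈-mapMaybe⁻ (cut-ratio G) (subsets n) q∈
... | S , ratio≡ with ratio⁻ ∣ S ∣ (w G S) ratio≡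
... | k , w≡ , q≡ = inj₂ (S , k , w≡ , trans eq (cong [_] q≡))

toughness-≤ : ∀ {n} (G : Graph n) S {k} → w G S ≡ suc (suc k) → toughness G ≤⁺.≤⁺ [ + ∣ S ∣ / suc (suc k) ]
toughness-≤ {n} G S {k} w≡ = All.lookup
  (Extrema.min≤xs ℚ⁺-totalOrder ⊤⁺ (map [_] (mapMaybe (cut-ratio G) (subsets n))))
  (∈-map⁺ [_] (∈-mapMaybe⁺ (cut-ratio G) (∈-subsets S) (cong (ratio ∣ S ∣) w≡)))

module _ {n} (G : Graph n) (τ≡ : toughness G ≡ [ + 3 / 2 ]) where

  3w≤2∣S∣ : ∀ S → 2 ≤ w G S → 3 * w G S ≤ 2 * ∣ S ∣
  3w≤2∣S∣ S 2≤w with w G S in w≡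
  3w≤2∣S∣ S (s≤s (s≤s _)) | suc (suc k) = subst (3 * suc (suc k) ≤_) (*-comm ∣ S ∣ 2)
    (/-≤ 3 1 ∣ S ∣ (suc k) (≤⁺.[≤]-injective (subst (≤⁺._≤⁺ [ + ∣ S ∣ / suc (suc k) ]) τ≡ (toughness-≤ G S w≡))))

  tough : Tough G
  tough {m} c ls respects ls! attained 2≤ls = ≤-trans (*-monoʳ-≤ 3 ls≤w)
    (≤-trans (3w≤2∣S∣ S (≤-trans 2≤ls ls≤w)) (*-monoʳ-≤ 2
      (count-tabulate-≥ (member? (off c)) id S S⊆off)))
    where
    S : Subset n
    S = Vec.tabulate (λ v → does (member? (off c) v))

    off⊆S : ∀ v → c v ≡ nothing → v Subset.∈ S
    off⊆S v cv = Vec.lookup⇒[]= v S (trans (Vec.lookup∘tabulate _ v) (yes′ (member? (off c) v)))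
      where
      yes′ : (d : Dec (c v ≡ nothing)) → does d ≡ true
      yes′ (yes _) = refl
      yes′ (no ¬p) = contradiction cv ¬p

    S⊆off : ∀ v → v Subset.∈ S → c v ≡ nothing
    S⊆off v v∈S = yes′ (member? (off c) v) (trans (sym (Vec.lookup∘tabulate _ v)) (Vec.[]=⇒lookup v∈S))
      where
      yes′ : (d : Dec (c v ≡ nothing)) → does d ≡ true → c v ≡ nothing
      yes′ (yes p) _ = p

    ls≤w : length ls ≤ w G S
    ls≤w = Components.labels≤components G S c ls respects ls! off⊆S S⊆off attained

  tight-cut : ∃ λ S → 2 ≤ w G S × 2 * ∣ S ∣ ≤ 3 * w G S
  tight-cut with toughness-attained G
  ... | inj₁ τ≡⊤ = contradiction (trans (sym τ≡) τ≡⊤) λ ()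
  ... | inj₂ (S , k , w≡ , τ≡q) = S , subst (2 ≤_) (sym w≡) (s≤s (s≤s z≤n)) ,
    subst₂ _≤_ (*-comm ∣ S ∣ 2) (cong (3 *_) (sym w≡))
      (/-≤ ∣ S ∣ (suc k) 3 1 (ℚ.≤-reflexive (unbracket (trans (sym τ≡q) τ≡))))
    where
    unbracket : ∀ {p q : ℚ} → [ p ] ≡ [ q ] → p ≡ q
    unbracket refl = refl

critical-edge : ∀ {n} (G : Graph n) {u v} → toughness (deleteEdge G u v) <⁺.<⁺ [ + 3 / 2 ] → Critical G u v
critical-edge {n} G {u} {v} τ< with toughness-attained (deleteEdge G u v)
... | inj₁ τ≡⊤ = contradiction (subst (<⁺._<⁺ [ + 3 / 2 ]) τ≡⊤ τ<) λ ()
... | inj₂ (S , k , w≡ , τ≡) = w H S , component , respects , component-onto ,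
  subst (2 ≤_) (sym w≡) (s≤s (s≤s z≤n)) , ≤-<-trans (*-monoʳ-≤ 2 card-off)
    (subst₂ _<_ (*-comm ∣ S ∣ 2) (cong (3 *_) (sym w≡))
      (/-< ∣ S ∣ (suc k) 3 1 (<⁺.[<]-injective (subst (<⁺._<⁺ [ + 3 / 2 ]) τ≡ τ<))))
  where
  H : Graph n
  H = deleteEdge G u v
  open Components H S
  respects : RespectsBut G u v component
  respects {x} {y} xy cx cy with ((x ≟ u) ×-dec (y ≟ v)) ⊎-dec ((x ≟ v) ×-dec (y ≟ u))
  ... | yes e = inj₂ e
  ... | no ¬e = inj₁ (component-respects (xy , ¬e) cx cy)

claw-free⇒noClaw : ∀ {n} (G : Graph n) → ClawFree G → NoClaw G
claw-free⇒noClaw {n} G clawFree {s} {a} {b} {c} sa sb sc a≢b a≢c b≢c ¬ab ¬ac ¬bc =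
  clawFree (f , injective , λ i j → mk⇔ (to i j) (from i j))
  where
  pattern 0F = zero
  pattern 1F = suc zero
  pattern 2F = suc (suc zero)
  pattern 3F = suc (suc (suc zero))

  f : Fin 4 → Fin n
  f 0F = s
  f 1F = a
  f 2F = b
  f 3F = c

  spoke : ∀ i → Adj G s (f (suc i))
  spoke 0F = sa
  spoke 1F = sb
  spoke 2F = sc

  to : ∀ i j → ClawAdj i j → Adj G (f i) (f j)
  to _ _ (centre-leaf i) = spoke i
  to _ _ (leaf-centre i) = symm G (spoke i)

  leaves : ∀ i j → ¬ Adj G (f (suc i)) (f (suc j))
  leaves 0F 0F = irrefl G refl
  leaves 0F 1F = ¬ab
  leaves 0F 2F = ¬ac
  leaves 1F 0F = ¬ab ∘ symm G
  leaves 1F 1F = irrefl G refl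
  leaves 1F 2F = ¬bc
  leaves 2F 0F = ¬ac ∘ symm G
  leaves 2F 1F = ¬bc ∘ symm G
  leaves 2F 2F = irrefl G refl

  from : ∀ i j → Adj G (f i) (f j) → ClawAdj i j
  from 0F 0F e = contradiction e (irrefl G refl)
  from 0F (suc j) e = centre-leaf j
  from (suc i) 0F e = leaf-centre i
  from (suc i) (suc j) e = contradiction e (leaves i j)

  distinct : ∀ i j → f (suc i) ≡ f (suc j) → i ≡ j
  distinct 0F 0F eq = refl
  distinct 0F 1F eq = contradiction eq a≢b
  distinct 0F 2F eq = contradiction eq a≢c
  distinct 1F 0F eq = contradiction (sym eq) a≢b
  distinct 1F 1F eq = refl
  distinct 1F 2F eq = contradiction eq b≢c
  distinct 2F 0F eq = contradiction (sym eq) a≢c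
  distinct 2F 1F eq = contradiction (sym eq) b≢c
  distinct 2F 2F eq = refl

  injective : ∀ {i j} → f i ≡ f j → i ≡ j
  injective {0F} {0F} eq = refl
  injective {0F} {suc j} eq = contradiction (spoke j) (irrefl G eq)
  injective {suc i} {0F} eq = contradiction (spoke i) (irrefl G (sym eq))
  injective {suc i} {suc j} eq = cong suc (distinct i j eq)

-- A tight cut yields a fragment

module Main {n} (G : Graph n) (τ≡ : toughness G ≡ [ + 3 / 2 ])
  (edges : ∀ u v → Adj G u v → toughness (deleteEdge G u v) <⁺.<⁺ [ + 3 / 2 ])
  (clawFree : ClawFree G) (no-degree-3 : ¬ (∃ λ v → degree G v ≡ 3)) where

  noClaw : NoClaw G
  noClaw = claw-free⇒noClaw G clawFree

  open ToughGraph G (tough G τ≡) noClaw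
  open Boundary G

  record TightLabelling : Set where
    field
      {m}      : ℕ
      c        : Labelling n (2 + m)
      respects : Respects G c
      onto     : ∀ l → ∃ λ v → c v ≡ just l
      tight    : 2 * card (off c) ≤ 3 * (2 + m)

  tightLabelling : TightLabelling
  tightLabelling =
    let S , 2≤w , tight = tight-cut G τ≡
        open Components G S
    in pack (w G S) component component-respects component-onto 2≤w (≤-trans (*-monoʳ-≤ 2 card-off) tight)
    where
    pack : ∀ m (c : Labelling n m) → Respects G c → (∀ l → ∃ λ v → c v ≡ just l) → 2 ≤ m →
      2 * card (off c) ≤ 3 * m → TightLabelling
    pack _ c respects onto (s≤s (s≤s _)) tight =
      record { c = c ; respects = respects ; onto = onto ; tight = tight }

  open TightLabelling tightLabelling

  labels : List (Fin (2 + m))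
  labels = allFin (2 + m)

  ∣labels∣ : length labels ≡ 2 + m
  ∣labels∣ = length-tabulate id

  labels! : Unique labels
  labels! = Unique.allFin⁺ (2 + m)

  2≤∣labels∣ : 2 ≤ length labels
  2≤∣labels∣ = subst (2 ≤_) (sym ∣labels∣) (s≤s (s≤s z≤n))

  3≤off : 3 ≤ card (off c)
  3≤off = *-cancelˡ-≤ 2 (≤-trans (*-monoʳ-≤ 3 2≤∣labels∣)
    (tough G τ≡ c labels respects labels! (λ {l} _ → onto l) 2≤∣labels∣))

  4≤n : 4 ≤ length (allFin n)
  4≤n = ≤-trans (s≤s 3≤off) (length-⊆ _≟_ {xs = proj₁ (onto zero) ∷ elements (off c)}
    (All.tabulate (λ { {o} o∈ refl → contradiction (trans (sym (∈-elements⁻ (off c) o∈)) (proj₂ (onto zero))) λ () })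
      ∷ elements! (off c))
    (λ {v} _ → ∈-allFin v))

  -- With fewer than three neighbours, one of the at least four vertices lies beyond them and is
  -- separated from `v`.
  3≤degree : ∀ v → 3 ≤ card (N v)
  3≤degree v = ≮⇒≥ λ lt →
    let o , _ , o∉ = pigeonhole _≟_ {ys = v ∷ elements (N v)} (Unique.allFin⁺ n) (≤-trans (s≤s (s≤s (s≤s⁻¹ lt))) 4≤n)
    in <⇒≱ lt (3-connected (fromList (v ∷ [])) (elements (N v)) (here refl)
         (λ o∈ → o∉ (here (Any.singleton⁻ o∈))) (λ o∈ → o∉ (there o∈))
         λ { u (_ , _ , here refl , vu) → ∈-elements⁺ (N v) vu })

  4≤degree : ∀ v → 4 ≤ card (N v)
  4≤degree v = ≤∧≢⇒< (3≤degree v) λ 3≡ → no-degree-3 (v , sym 3≡)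

  -- A class of a tight cut is a fragment, with a second class in its exterior.
  absurd : ⊥
  absurd = no-fragment G (tough G τ≡) noClaw 4≤degree (λ {u} {v} uv → critical-edge G (edges u v uv))
    (class c zero) (proj₂ (onto zero))
    (other-class-exterior c respects {l′ = suc zero} (λ ()) (proj₂ (onto (suc zero))))
    (tight-classes c respects labels labels! (λ {l} _ → onto l) 2≤∣labels∣
      (subst (λ k → 2 * card (off c) ≤ 3 * k) (sym ∣labels∣) tight) (∈-allFin zero))

theorem1p7 : ∀ (n : ℕ) (G : Graph n) → MinimallyTough (+ 3 / 2) G → ClawFree G →
    ∃[ v ] degree G v ≡ 3
theorem1p7 n G (τ≡ , edges) clawFree with any? (λ v → degree G v ℕ.≟ 3)
... | yes found = found
... | no none = ⊥-elim (Main.absurd G τ≡ edges clawFree none)
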